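{- Define integers $D'(n)$, $n\ge1$, by \[ \sum_{n=1}^\infty D'(n) q^n := \sum_{n=1}^\infty q^{2n}(q^{n+1};q)_\infty^3 (q^{n};q)_{n}. \] Then \[ \sum_{n=1}^\infty D'(n) q^{8n+2} = 2 \sum_{r,n=0}^\infty (-1)^{n} q^{(2r+1)^2 + (2r+1+2n)^2} - \sum_{n=0}^\infty (-1)^{n}(n+1) q^{1+(2n+1)^2} - \sum_{n=0}^\infty q^{2(2n+1)^2}. \]
   Context: Here $q$ is a complex number with $|q|<1$ (equivalently, identities of formal power series in $q$). Notation: $(a;q)_0=1$, $(a;q)_n=\prod_{j=0}^{n-1}(1-aq^j)$, $(a;q)_\infty=\prod_{j=0}^{\infty}(1-aq^j)$, and $(a;q)_\infty^k$ denotes the $k$-th power of $(a;q)_\infty$. -}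

module Defs where

open import Data.Nat as ℕ using (ℕ; zero; suc; _∸_; _≤?_)
open import Data.Integer as ℤ using (ℤ; +_; -_; _+_; _*_; _-_)
open import Relation.Nullary using (yes; no)

-- Formal power series in q with integer coefficients: the n-th entry is the
-- coefficient of q^n.
PS : Set
PS = ℕ → ℤ

infixl 6 _⊕_ _⊖_
infixl 7 _⊛_

_⊕_ : PS → PS → PS
(f ⊕ g) n = f n + g n

_⊖_ : PS → PS → PS
(f ⊖ g) n = f n - g n

scale : ℤ → PS → PS
scale c f n = c * f n

sumℤ : ℕ → (ℕ → ℤ) → ℤ
sumℤ zero    a = + 0
sumℤ (suc k) a = sumℤ k a + a k

_⊛_ : PS → PS → PS
(f ⊛ g) n = sumℤ (suc n) (λ k → f k * g (n ∸ k))

mono : ℤ → ℕ → PS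
mono c e n with n ℕ.≟ e
... | yes _ = c
... | no  _ = + 0

one : PS
one = mono (+ 1) 0

oneMinusQ : ℕ → PS
oneMinusQ e = one ⊖ mono (+ 1) e

sumPS : ℕ → (ℕ → PS) → PS
sumPS zero    F = λ _ → + 0
sumPS (suc k) F = sumPS k F ⊕ F k

prodPS : ℕ → (ℕ → PS) → PS
prodPS zero    F = one
prodPS (suc k) F = prodPS k F ⊛ F k

-- Infinite sum Σ_{i ≥ 0} F i, defined coefficientwise by truncation:
-- coefficient of q^N is that of Σ_{i ≤ N} F i.  This is the formal sum
-- whenever F i has q-adic order > N for all i > N (true for all uses below).
sumInf : (ℕ → PS) → PS
sumInf F N = sumPS (suc N) F N

poch : ℕ → ℕ → PS
poch m n = prodPS n (λ j → oneMinusQ (m ℕ.+ j))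

-- (q^m ; q)_∞ as a formal power series: the coefficient of q^N agrees with that
-- of the finite product Π_{j ≤ N} (1 - q^{m+j}), since the other factors are
-- ≡ 1 mod q^{N+1}.
pochInf : ℕ → PS
pochInf m N = poch m (suc N) N

signPow : ℕ → ℤ
signPow zero    = + 1
signPow (suc n) = - signPow n

shift : ℕ → PS → PS
shift e f = mono (+ 1) e ⊛ f

cube : PS → PS
cube f = f ⊛ f ⊛ f

D'gen : PS
D'gen = sumInf (λ i → let n = suc i in
          shift (2 ℕ.* n) (cube (pochInf (suc n)) ⊛ poch n n))

D' : ℕ → ℤ
D' n = D'gen n

lhs : PS
lhs = sumInf (λ i → let n = suc i in mono (D' n) (8 ℕ.* n ℕ.+ 2))

sq : ℕ → ℕ
sq k = k ℕ.* k

rhs : PS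
rhs = scale (+ 2) (sumInf (λ r → sumInf (λ n →
          mono (signPow n) (sq (2 ℕ.* r ℕ.+ 1) ℕ.+ sq (2 ℕ.* r ℕ.+ 1 ℕ.+ 2 ℕ.* n)))))
    ⊖ sumInf (λ n → mono (signPow n * + (suc n)) (1 ℕ.+ sq (2 ℕ.* n ℕ.+ 1)))
    ⊖ sumInf (λ n → mono (+ 1) (2 ℕ.* sq (2 ℕ.* n ℕ.+ 1)))

{-# OPTIONS --safe #-}
module Submission where

-- Let θ(b) = Σ_{n ≥ 0} (-1)ⁿ bⁿ q^(n(n-1)/2), so that θ(b) = 1 - b θ(b q), and
--   G(a,b) = Σ_{n ≥ 0} qⁿ (a b q^(n-1);q)_n (q^(n+1), a qⁿ, b qⁿ;q)_∞.
-- Comparing summands gives G(a,b) = (1-a) G(aq,b) + a q G(aq²,b), so G(a,b) + a G(aq,b)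
-- does not change under a ↦ aq and equals G(0,b); since G(0,0) = 1, the Andrews–Warnaar
-- product formula G(a,b) = θ(a) θ(b) follows.  Subtracting t q G(q,tq²) from G(1,tq)
-- yields (1-t) E(t) = θ(tq) - θ(q), where
--   E(t) = Σ_{n ≥ 1} qⁿ (t q^(n+1);q)_(n-1) (q^(n+1), qⁿ, t q^(n+1);q)_∞,
-- and dual numbers, t = 1 + ε, give E(1) = - Σ (-1)ⁿ n q^(n(n+1)/2).  The generating
-- function of D' is E(1) - G(1,q) = θ(q)² - Σ (-1)ⁿ (n+1) q^(n(n+1)/2), and unfolding the
-- square θ(q)² along its diagonal gives the double sum of the theorem.

import Algebra.Module.Construct.Idealization as Idealization
import Algebra.Module.Construct.TensorUnit as TensorUnit
open import Algebra.Bundles using (CommutativeRing)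
open import Algebra.Solver.Ring.AlmostCommutativeRing
  using (fromCommutativeRing; _-Raw-AlmostCommutative⟶_; Induced-equivalence)
open import Data.Integer.Base as ℤ using (ℤ; +_; -[1+_])
import Data.Integer.Properties as ℤ
open import Data.Integer.Tactic.RingSolver using (solve-∀)
open import Data.Maybe.Base using (just; nothing)
open import Data.Nat.Base as ℕ using (ℕ; zero; suc; pred; _∸_; _≤_; _<_; z≤n; s≤s)
import Data.Nat.Properties as ℕ
import Data.Nat.Tactic.RingSolver as ℕSolver
open import Data.Product.Base as Product using (∃; _,_; proj₁; proj₂)
open import Data.Sum.Base using (inj₁; inj₂)
open import Function.Base using (_∘_)
open import Relation.Binary.Definitions using (WeaklyDecidable)
import Relation.Binary.PropositionalEquality as ≡
open ≡ using (_≡_; _≢_)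
open import Relation.Nullary using (Dec; yes; no; contradiction)
open import Defs

-- A ring solver with integer coefficients

module IntegerCoefficients {c ℓ} (R : CommutativeRing c ℓ) where
  open CommutativeRing R
  open import Algebra.Properties.Ring ring
  open import Algebra.Properties.Semiring.Mult.TCOptimised semiring
  open import Relation.Binary.Reasoning.Setoid setoid

  -- The canonical homomorphism from the integers. Normalisation has to compare coefficients, and
  -- equality of integers is decidable while `≈` in `R` need not be.
  fromℤ : ℤ → Carrier
  fromℤ (+ n)    = n × 1#
  fromℤ -[1+ n ] = - (suc n × 1#)

  fromℤ-⊖ : ∀ m n → fromℤ (m ℤ.⊖ n) ≈ m × 1# - n × 1#
  fromℤ-⊖ m zero = sym (trans (+-congˡ -0#≈0#) (+-identityʳ _))
  fromℤ-⊖ zero (suc n) = sym (+-identityˡ _)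
  fromℤ-⊖ (suc m) (suc n) = begin
    fromℤ (suc m ℤ.⊖ suc n)           ≡⟨ ≡.cong fromℤ (ℤ.[1+m]⊖[1+n]≡m⊖n m n) ⟩
    fromℤ (m ℤ.⊖ n)                   ≈⟨ fromℤ-⊖ m n ⟩
    m × 1# - n × 1#                   ≈⟨ +-identityˡ _ ⟨
    0# + (m × 1# - n × 1#)            ≈⟨ +-congʳ (-‿inverseʳ 1#) ⟨
    (1# - 1#) + (m × 1# - n × 1#)     ≈⟨ interchange 1# (- 1#) (m × 1#) (- (n × 1#)) ⟩
    (1# + m × 1#) + (- 1# - n × 1#)   ≈⟨ +-congˡ (-‿+-comm 1# (n × 1#)) ⟩
    (1# + m × 1#) - (1# + n × 1#)     ≈⟨ +-cong (1+× m 1#) (-‿cong (1+× n 1#)) ⟨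
    suc m × 1# - suc n × 1#           ∎
    where open import Algebra.Properties.CommutativeSemigroup +-commutativeSemigroup

  fromℤ-+ : ∀ i j → fromℤ (i ℤ.+ j) ≈ fromℤ i + fromℤ j
  fromℤ-+ (+ m)    (+ n)    = ×-homo-+ 1# m n
  fromℤ-+ (+ m)    -[1+ n ] = fromℤ-⊖ m (suc n)
  fromℤ-+ -[1+ m ] (+ n)    = trans (fromℤ-⊖ n (suc m)) (+-comm _ _)
  fromℤ-+ -[1+ m ] -[1+ n ] = begin
    - (suc (suc (m ℕ.+ n)) × 1#)      ≡⟨ ≡.cong (λ k → - (k × 1#)) (≡.sym (≡.cong suc (ℕ.+-suc m n))) ⟩
    - ((suc m ℕ.+ suc n) × 1#)        ≈⟨ -‿cong (×-homo-+ 1# (suc m) (suc n)) ⟩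
    - (suc m × 1# + suc n × 1#)       ≈⟨ -‿+-comm _ _ ⟨
    - (suc m × 1#) - (suc n × 1#)     ∎

  fromℤ-neg : ∀ i → fromℤ (ℤ.- i) ≈ - fromℤ i
  fromℤ-neg (+ zero)  = sym -0#≈0#
  fromℤ-neg (+ suc n) = refl
  fromℤ-neg -[1+ n ]  = sym (-‿involutive _)

  fromℤ-*-pos : ∀ m n → fromℤ ((+ m) ℤ.* (+ n)) ≈ fromℤ (+ m) * fromℤ (+ n)
  fromℤ-*-pos m n = trans (reflexive (≡.cong fromℤ (≡.sym (ℤ.pos-* m n)))) (×1-homo-* m n)

  fromℤ-*ˡ : ∀ i n → fromℤ (i ℤ.* (+ n)) ≈ fromℤ i * fromℤ (+ n)
  fromℤ-*ˡ (+ m)    n = fromℤ-*-pos m n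
  fromℤ-*ˡ -[1+ m ] n = begin
    fromℤ (-[1+ m ] ℤ.* (+ n))        ≡⟨ ≡.cong fromℤ (ℤ.neg-distribˡ-* (+ suc m) (+ n)) ⟨
    fromℤ (ℤ.- ((+ suc m) ℤ.* (+ n))) ≈⟨ fromℤ-neg ((+ suc m) ℤ.* (+ n)) ⟩
    - fromℤ ((+ suc m) ℤ.* (+ n))     ≈⟨ -‿cong (fromℤ-*-pos (suc m) n) ⟩
    - (fromℤ (+ suc m) * fromℤ (+ n)) ≈⟨ -‿distribˡ-* _ _ ⟩
    fromℤ -[1+ m ] * fromℤ (+ n)      ∎

  fromℤ-* : ∀ i j → fromℤ (i ℤ.* j) ≈ fromℤ i * fromℤ j
  fromℤ-* i (+ n)    = fromℤ-*ˡ i n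
  fromℤ-* i -[1+ n ] = begin
    fromℤ (i ℤ.* -[1+ n ])         ≡⟨ ≡.cong fromℤ (ℤ.neg-distribʳ-* i (+ suc n)) ⟨
    fromℤ (ℤ.- (i ℤ.* (+ suc n)))  ≈⟨ fromℤ-neg (i ℤ.* (+ suc n)) ⟩
    - fromℤ (i ℤ.* (+ suc n))      ≈⟨ -‿cong (fromℤ-*ˡ i (suc n)) ⟩
    - (fromℤ i * fromℤ (+ suc n))  ≈⟨ -‿distribʳ-* _ _ ⟩
    fromℤ i * fromℤ -[1+ n ]       ∎

  morphism : ℤ.+-*-rawRing -Raw-AlmostCommutative⟶ fromCommutativeRing R
  morphism = record
    { ⟦_⟧    = fromℤ
    ; +-homo = fromℤ-+
    ; *-homo = fromℤ-*
    ; -‿homo = fromℤ-neg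
    ; 0-homo = refl
    ; 1-homo = refl
    }

  _coeff≟_ : WeaklyDecidable (Induced-equivalence morphism)
  i coeff≟ j with i ℤ.≟ j
  ... | yes i≡j = just (reflexive (≡.cong fromℤ i≡j))
  ... | no  _   = nothing

  open import Algebra.Solver.Ring ℤ.+-*-rawRing (fromCommutativeRing R) morphism _coeff≟_ public
    using (con; _:+_; _:*_; _:-_; :-_; _:=_; solve)

-- The Andrews–Warnaar identity and its derivative

module FiniteSums {c ℓ} (R : CommutativeRing c ℓ) where
  open CommutativeRing R
  open import Algebra.Properties.CommutativeSemigroup +-commutativeSemigroup using (interchange)

  ∑ : ℕ → (ℕ → Carrier) → Carrier
  ∑ zero    f = 0#
  ∑ (suc n) f = ∑ n f + f n

  ∑-cong : ∀ n {f g} → (∀ i → f i ≈ g i) → ∑ n f ≈ ∑ n g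
  ∑-cong zero    f≈g = refl
  ∑-cong (suc n) f≈g = +-cong (∑-cong n f≈g) (f≈g n)

  ∑-cons : ∀ n f → ∑ (suc n) f ≈ f 0 + ∑ n (λ i → f (suc i))
  ∑-cons zero    f = +-comm _ _
  ∑-cons (suc n) f = trans (+-congʳ (∑-cons n f)) (+-assoc _ _ _)

  ∑-+ : ∀ n f g → ∑ n (λ i → f i + g i) ≈ ∑ n f + ∑ n g
  ∑-+ zero    f g = sym (+-identityˡ 0#)
  ∑-+ (suc n) f g = trans (+-congʳ (∑-+ n f g)) (interchange _ _ _ _)

  ∑-*ˡ : ∀ n x f → ∑ n (λ i → x * f i) ≈ x * ∑ n f
  ∑-*ˡ zero    x f = sym (zeroʳ x)
  ∑-*ˡ (suc n) x f = trans (+-congʳ (∑-*ˡ n x f)) (sym (distribˡ _ _ _))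

  ∑-*ʳ : ∀ n x f → ∑ n (λ i → f i * x) ≈ ∑ n f * x
  ∑-*ʳ n x f = trans (∑-cong n (λ i → *-comm _ _)) (trans (∑-*ˡ n x f) (*-comm _ _))

-- q-Pochhammer symbols and partial theta functions

module QSeries {c ℓ} (R : CommutativeRing c ℓ) (q : CommutativeRing.Carrier R) where
  open CommutativeRing R
  open import Algebra.Properties.Semiring.Exp semiring public using (_^_)
  open IntegerCoefficients R
  open FiniteSums R public
  open import Algebra.Properties.Ring ring using (-‿distribˡ-*; -1*x≈-x)
  open import Relation.Binary.Reasoning.Setoid setoid

  x-0#≈x : ∀ x → x - 0# ≈ x
  x-0#≈x = solve 1 (λ x → x :- con (+ 0) := x) refl

  infix 9 ⟪_⟫_

  -- The q-Pochhammer symbol (x;q)_n.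
  ⟪_⟫_ : Carrier → ℕ → Carrier
  ⟪ x ⟫ zero  = 1#
  ⟪ x ⟫ suc n = ⟪ x ⟫ n * (1# - x * q ^ n)

  ⟪⟫-cong : ∀ n {x y} → x ≈ y → ⟪ x ⟫ n ≈ ⟪ y ⟫ n
  ⟪⟫-cong zero    x≈y = refl
  ⟪⟫-cong (suc n) x≈y = *-cong (⟪⟫-cong n x≈y) (+-congˡ (-‿cong (*-congʳ x≈y)))

  -- The definition appends the last factor; the recurrences in `a` and `b` need the first one split
  -- off.
  ⟪⟫-cons : ∀ x n → ⟪ x ⟫ suc n ≈ (1# - x) * ⟪ x * q ⟫ n
  ⟪⟫-cons x zero    = solve 1 (λ x → con (+ 1) :* (con (+ 1) :- x :* con (+ 1)) := (con (+ 1) :- x) :* con (+ 1)) refl x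
  ⟪⟫-cons x (suc n) = begin
    ⟪ x ⟫ suc n * (1# - x * (q * q ^ n))             ≈⟨ *-congʳ (⟪⟫-cons x n) ⟩
    (1# - x) * ⟪ x * q ⟫ n * (1# - x * (q * q ^ n))  ≈⟨ *-congˡ (+-congˡ (-‿cong (sym (*-assoc x q (q ^ n))))) ⟩
    (1# - x) * ⟪ x * q ⟫ n * (1# - x * q * q ^ n)    ≈⟨ *-assoc _ _ _ ⟩
    (1# - x) * ⟪ x * q ⟫ suc n                       ∎

  ⟪0⟫ : ∀ n → ⟪ 0# ⟫ n ≈ 1#
  ⟪0⟫ zero    = refl
  ⟪0⟫ (suc n) = begin
    ⟪ 0# ⟫ n * (1# - 0# * q ^ n) ≈⟨ *-cong (⟪0⟫ n) (+-congˡ (-‿cong (zeroˡ _))) ⟩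
    1# * (1# - 0#)               ≈⟨ *-identityˡ _ ⟩
    1# - 0#                      ≈⟨ x-0#≈x 1# ⟩
    1#                           ∎

  -- (- 1)^n bⁿ q^(n (n - 1) / 2), in the form that makes the functional equation of P immediate.
  s : ℕ → Carrier → Carrier
  s zero    b = 1#
  s (suc n) b = - b * s n (b * q)

  s-cong : ∀ n {x y} → x ≈ y → s n x ≈ s n y
  s-cong zero    x≈y = refl
  s-cong (suc n) x≈y = *-cong (-‿cong x≈y) (s-cong n (*-congʳ x≈y))

  -- Each of the n factors of the product has an argument that is a multiple of q. This is what
  -- makes late terms vanish modulo q^N.
  s-divisible : ∀ n c → ∃ λ r → s n (c * q) ≈ q ^ n * r
  s-divisible zero    c = 1# , sym (*-identityˡ 1#)
  s-divisible (suc n) c with r , eq ← s-divisible n (c * q) = - c * r , (begin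
    - (c * q) * s n (c * q * q) ≈⟨ *-congˡ eq ⟩
    - (c * q) * (q ^ n * r)     ≈⟨ solve 4 (λ c q y r → :- (c :* q) :* (y :* r) := q :* y :* (:- c :* r)) refl c q (q ^ n) r ⟩
    q * q ^ n * (- c * r)       ∎)

  P : ℕ → Carrier → Carrier
  P M b = ∑ M (λ n → s n b)

  P-cong : ∀ M {x y} → x ≈ y → P M x ≈ P M y
  P-cong M x≈y = ∑-cong M (λ n → s-cong n x≈y)

  P-cons : ∀ M b → P (suc M) b ≈ 1# - b * P M (b * q)
  P-cons M b = begin
    P (suc M) b                              ≈⟨ ∑-cons M _ ⟩
    1# + ∑ M (λ n → - b * s n (b * q))       ≈⟨ +-congˡ (∑-*ˡ M (- b) _) ⟩
    1# + - b * P M (b * q)                   ≈⟨ +-congˡ (-‿distribˡ-* _ _) ⟨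
    1# - b * P M (b * q)                     ∎

  -- Setting q ^ N ≈ 0 works modulo q^N, so that all infinite sums and products can be truncated.
  module Truncated (N : ℕ) (q^N≈0 : q ^ N ≈ 0#) where

    q^≈0 : ∀ {n} → N ≤ n → q ^ n ≈ 0#
    q^≈0 N≤n with k , ≡.refl ← ℕ.m≤n⇒∃[o]m+o≡n N≤n = begin
      q ^ (N ℕ.+ k)  ≈⟨ ^-homo-* q N k ⟩
      q ^ N * q ^ k  ≈⟨ *-congʳ q^N≈0 ⟩
      0# * q ^ k     ≈⟨ zeroˡ _ ⟩
      0#             ∎
      where open import Algebra.Properties.Semiring.Exp semiring using (^-homo-*)

    -- Stands for (x;q)_∞: the omitted factors 1 - x qⁿ with n ≥ N are all equal to 1 here.
    φ : Carrier → Carrier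
    φ x = ⟪ x ⟫ N

    φ-cong : ∀ {x y} → x ≈ y → φ x ≈ φ y
    φ-cong = ⟪⟫-cong N

    φ-cons : ∀ x → φ x ≈ (1# - x) * φ (x * q)
    φ-cons x = begin
      φ x                     ≈⟨ *-identityʳ _ ⟨
      φ x * 1#                ≈⟨ *-congˡ (x-0#≈x 1#) ⟨
      φ x * (1# - 0#)         ≈⟨ *-congˡ (+-congˡ (-‿cong (zeroʳ x))) ⟨
      φ x * (1# - x * 0#)     ≈⟨ *-congˡ (+-congˡ (-‿cong (*-congˡ q^N≈0))) ⟨
      φ x * (1# - x * q ^ N)  ≈⟨ ⟪⟫-cons x N ⟩
      (1# - x) * φ (x * q)    ∎

    φ-cons′ : ∀ x {y} → x * q ≈ y → φ x ≈ (1# - x) * φ y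
    φ-cons′ x eq = trans (φ-cons x) (*-congˡ (φ-cong eq))

    φ1≈0 : φ 1# ≈ 0#
    φ1≈0 = trans (φ-cons 1#) (trans (*-congʳ (-‿inverseʳ 1#)) (zeroˡ _))

    -- In `P-cons` the sum on the right is one term shorter; the missing term `s M (b * q)` is a
    -- multiple of q^M and hence zero.
    P-rec : ∀ {M} → N ≤ M → ∀ b → P (suc M) b ≈ 1# - b * P (suc M) (b * q)
    P-rec {M} N≤M b with r , eq ← s-divisible M b = begin
      P (suc M) b                                ≈⟨ P-cons M b ⟩
      1# - b * P M (b * q)                       ≈⟨ +-congˡ (-‿cong (*-congˡ (+-identityʳ _))) ⟨
      1# - b * (P M (b * q) + 0#)                ≈⟨ +-congˡ (-‿cong (*-congˡ (+-congˡ s≈0))) ⟨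
      1# - b * P (suc M) (b * q)                 ∎
      where
      s≈0 : s M (b * q) ≈ 0#
      s≈0 = trans eq (trans (*-congʳ (q^≈0 N≤M)) (zeroˡ r))

    -- The difference of two solutions satisfies Δ(b) = - b Δ(b q). Every iteration at an argument
    -- that is a multiple of q contributes a factor q, so N of them give zero.
    functional-eq-unique : ∀ {c} (X Y : Carrier → Carrier) →
      (∀ b → X b ≈ c - b * X (b * q)) → (∀ b → Y b ≈ c - b * Y (b * q)) → ∀ b → X b ≈ Y b
    functional-eq-unique {c} X Y X-rec Y-rec b = begin
      X b           ≈⟨ solve 2 (λ x y → x := (x :- y) :+ y) refl (X b) (Y b) ⟩
      Δ b + Y b     ≈⟨ +-congʳ Δ≈0 ⟩
      0# + Y b      ≈⟨ +-identityˡ _ ⟩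
      Y b           ∎
      where
      Δ : Carrier → Carrier
      Δ b = X b - Y b

      Δ-rec : ∀ b → Δ b ≈ - b * Δ (b * q)
      Δ-rec b = begin
        X b - Y b                                    ≈⟨ +-cong (X-rec b) (-‿cong (Y-rec b)) ⟩
        (c - b * X (b * q)) - (c - b * Y (b * q))    ≈⟨ solve 4 (λ c b x y → (c :- b :* x) :- (c :- b :* y) := :- b :* (x :- y)) refl c b (X (b * q)) (Y (b * q)) ⟩
        - b * Δ (b * q)                              ∎

      Δ-divisible : ∀ k x → ∃ λ r → Δ (x * q) ≈ q ^ k * r
      Δ-divisible zero    x = Δ (x * q) , sym (*-identityˡ _)
      Δ-divisible (suc k) x with r , eq ← Δ-divisible k (x * q) = - x * r , (begin
        Δ (x * q)                    ≈⟨ Δ-rec (x * q) ⟩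
        - (x * q) * Δ (x * q * q)    ≈⟨ *-congˡ eq ⟩
        - (x * q) * (q ^ k * r)      ≈⟨ solve 4 (λ c q y r → :- (c :* q) :* (y :* r) := q :* y :* (:- c :* r)) refl x q (q ^ k) r ⟩
        q * q ^ k * (- x * r)        ∎)

      Δ≈0 : Δ b ≈ 0#
      Δ≈0 with r , eq ← Δ-divisible N b = begin
        Δ b                 ≈⟨ Δ-rec b ⟩
        - b * Δ (b * q)     ≈⟨ *-congˡ eq ⟩
        - b * (q ^ N * r)   ≈⟨ *-congˡ (*-congʳ q^N≈0) ⟩
        - b * (0# * r)      ≈⟨ *-congˡ (zeroˡ r) ⟩
        - b * 0#            ≈⟨ zeroʳ _ ⟩
        0#                  ∎

    -- The sum G(a,b) and its functional equation

    ⟪⟫-pred : ∀ n x → ⟪ x * q * q ^ pred n ⟫ n ≈ ⟪ x * q ^ n ⟫ n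
    ⟪⟫-pred zero    x = refl
    ⟪⟫-pred (suc n) x = ⟪⟫-cong (suc n) (*-assoc x q (q ^ n))

    -- The summand of G(a,b). At n = 0 the exponent n - 1 is read as 0, which is harmless because
    -- the finite product is then empty; `⟪⟫-pred` relies on the same fact.
    T : Carrier → Carrier → ℕ → Carrier
    T a b n = q ^ n * (⟪ a * b * q ^ pred n ⟫ n * (φ (q * q ^ n) * (φ (a * q ^ n) * φ (b * q ^ n))))

    T-cong : ∀ n {a a′ b b′} → a ≈ a′ → b ≈ b′ → T a b n ≈ T a′ b′ n
    T-cong n a≈ b≈ = *-congˡ (*-cong (⟪⟫-cong n (*-congʳ (*-cong a≈ b≈)))
      (*-congˡ (*-cong (φ-cong (*-congʳ a≈)) (φ-cong (*-congʳ b≈)))))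

    T-sym : ∀ n a b → T a b n ≈ T b a n
    T-sym n a b = *-congˡ (*-cong (⟪⟫-cong n (*-congʳ (*-comm a b))) (*-congˡ (*-comm _ _)))

    T-zero : ∀ a b → T a b 0 ≈ (1# - a) * T (a * q) b 0
    T-zero a b = begin
      1# * (1# * (Q * (φ (a * 1#) * B)))
        ≈⟨ *-congˡ (*-congˡ (*-congˡ (*-congʳ (trans (φ-cong (*-identityʳ a)) (φ-cons′ a (sym (*-identityʳ (a * q)))))))) ⟩
      1# * (1# * (Q * ((1# - a) * A * B)))
        ≈⟨ solve 4 (λ a Q A B → con (+ 1) :* (con (+ 1) :* (Q :* ((con (+ 1) :- a) :* A :* B)))
                             := (con (+ 1) :- a) :* (con (+ 1) :* (con (+ 1) :* (Q :* (A :* B))))) refl a Q A B ⟩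
      (1# - a) * (1# * (1# * (Q * (A * B)))) ∎
      where
      Q = φ (q * 1#)
      A = φ (a * q * 1#)
      B = φ (b * 1#)

    T-suc : ∀ n a b → T a b (suc n) ≈ (1# - a) * T (a * q) b (suc n) + a * q * T (a * q * q) b n
    T-suc n a b = begin
      T a b (suc n)
        ≈⟨ *-congˡ (*-cong (trans (⟪⟫-cons (a * b * y) n) (*-congˡ (⟪⟫-cong n
             (solve 4 (λ a b y q → a :* b :* y :* q := a :* q :* b :* y) refl a b y q))))
           (*-congˡ (*-congʳ (φ-cons′ (a * (q * y))
             (solve 3 (λ a q y → a :* (q :* y) :* q := a :* q :* (q :* y)) refl a q y))))) ⟩
      q * y * ((1# - a * b * y) * V * (Q * ((1# - a * (q * y)) * A * B)))
        -- Without the common products `V`, `Q`, `A`, `B` and the factor q y, this is (1 - a b y)(1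
        -- - a q y) = (1 - a)(1 - a b q y²) + a (1 - q y)(1 - b y).
        ≈⟨ solve 8 (λ a b q y V Q A B →
             q :* y :* ((con (+ 1) :- a :* b :* y) :* V :* (Q :* ((con (+ 1) :- a :* (q :* y)) :* A :* B)))
               := (con (+ 1) :- a) :* (q :* y :* (V :* (con (+ 1) :- a :* q :* b :* y :* y) :* (Q :* (A :* B))))
               :+ a :* q :* (y :* (V :* ((con (+ 1) :- q :* y) :* Q :* (A :* ((con (+ 1) :- b :* y) :* B))))))
             refl a b q y V Q A B ⟩
      (1# - a) * T (a * q) b (suc n) + a * q * (y * (V * ((1# - q * y) * Q * (A * ((1# - b * y) * B)))))
        ≈⟨ +-congˡ (*-congˡ (*-congˡ (*-cong
             (trans (⟪⟫-cong n (solve 4 (λ a q b z → a :* q :* q :* b :* z := a :* q :* b :* q :* z) refl a q b (q ^ pred n)))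
               (⟪⟫-pred n (a * q * b)))
             (*-cong (φ-cons′ (q * y) (*-comm _ _))
               (*-cong (φ-cong (*-assoc (a * q) q y))
                 (φ-cons′ (b * y) (solve 3 (λ b q y → b :* y :* q := b :* (q :* y)) refl b q y))))))) ⟨
      (1# - a) * T (a * q) b (suc n) + a * q * T (a * q * q) b n ∎
      where
      y = q ^ n
      V = ⟪ a * q * b * y ⟫ n
      Q = φ (q * (q * y))
      A = φ (a * q * (q * y))
      B = φ (b * (q * y))

    -- The term with index `N` is already zero. It is kept so that splitting off the first term
    -- leaves `N` shifted terms, which `G-init` again identifies with a full sum.
    G : Carrier → Carrier → Carrier
    G a b = ∑ (suc N) (T a b)

    G-cong : ∀ {a a′ b b′} → a ≈ a′ → b ≈ b′ → G a b ≈ G a′ b′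
    G-cong a≈ b≈ = ∑-cong (suc N) (λ n → T-cong n a≈ b≈)

    G-sym : ∀ a b → G a b ≈ G b a
    G-sym a b = ∑-cong (suc N) (λ n → T-sym n a b)

    T-N≈0 : ∀ a b → T a b N ≈ 0#
    T-N≈0 a b = trans (*-congʳ q^N≈0) (zeroˡ _)

    G-init : ∀ a b → G a b ≈ ∑ N (T a b)
    G-init a b = trans (+-congˡ (T-N≈0 a b)) (+-identityʳ _)

    G-rec : ∀ a b → G a b ≈ (1# - a) * G (a * q) b + a * q * G (a * q * q) b
    G-rec a b = begin
      G a b
        ≈⟨ ∑-cons N (T a b) ⟩
      T a b 0 + ∑ N (λ n → T a b (suc n))
        ≈⟨ +-cong (T-zero a b) (∑-cong N (λ n → T-suc n a b)) ⟩
      (1# - a) * T (a * q) b 0 + ∑ N (λ n → (1# - a) * T (a * q) b (suc n) + a * q * T (a * q * q) b n)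
        ≈⟨ +-congˡ (trans (∑-+ N _ _) (+-cong (∑-*ˡ N (1# - a) _) (∑-*ˡ N (a * q) _))) ⟩
      (1# - a) * T (a * q) b 0 + ((1# - a) * ∑ N (λ n → T (a * q) b (suc n)) + a * q * ∑ N (T (a * q * q) b))
        ≈⟨ +-assoc _ _ _ ⟨
      (1# - a) * T (a * q) b 0 + (1# - a) * ∑ N (λ n → T (a * q) b (suc n)) + a * q * ∑ N (T (a * q * q) b)
        ≈⟨ +-cong (trans (*-congˡ (∑-cons N _)) (distribˡ _ _ _)) (*-congˡ (G-init (a * q * q) b)) ⟨
      (1# - a) * G (a * q) b + a * q * G (a * q * q) b ∎

    -- By `G-rec` the combination `H` is unchanged under a ↦ a q. After `N` such steps its argument
    -- a q^N is zero, which plays the part of the limit.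
    G-functional-eq : ∀ a b → G a b ≈ G 0# b - a * G (a * q) b
    G-functional-eq a b = begin
      G a b                        ≈⟨ solve 2 (λ x y → x := (x :+ y) :- y) refl (G a b) (a * G (a * q) b) ⟩
      H a - a * G (a * q) b        ≈⟨ +-congʳ (trans (H-iter N a) H-lim) ⟩
      G 0# b - a * G (a * q) b     ∎
      where
      H : Carrier → Carrier
      H a = G a b + a * G (a * q) b

      H-step : ∀ a → H a ≈ H (a * q)
      H-step a = trans (+-congʳ (G-rec a b))
        (solve 4 (λ a q g h → (con (+ 1) :- a) :* g :+ a :* q :* h :+ a :* g := g :+ a :* q :* h)
           refl a q (G (a * q) b) (G (a * q * q) b))

      H-cong : ∀ {x y} → x ≈ y → H x ≈ H y
      H-cong eq = +-cong (G-cong eq refl) (*-cong eq (G-cong (*-congʳ eq) refl))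

      H-iter : ∀ k a → H a ≈ H (a * q ^ k)
      H-iter zero    a = H-cong (sym (*-identityʳ a))
      H-iter (suc k) a = trans (H-step a) (trans (H-iter k (a * q)) (H-cong (*-assoc a q (q ^ k))))

      H-lim : H (a * q ^ N) ≈ G 0# b
      H-lim = begin
        H (a * q ^ N)            ≈⟨ H-cong (trans (*-congˡ q^N≈0) (zeroʳ a)) ⟩
        G 0# b + 0# * G (0# * q) b ≈⟨ +-congˡ (zeroˡ _) ⟩
        G 0# b + 0#              ≈⟨ +-identityʳ _ ⟩
        G 0# b                   ∎

    -- The summand is qⁿ (q^(n+1);q)_∞ = (q^(n+1);q)_∞ - (qⁿ;q)_∞, so the sum telescopes from
    -- (1;q)_∞ = 0 to a product that is 1 modulo q^N.
    G00≈1 : G 0# 0# ≈ 1#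
    G00≈1 = begin
      G 0# 0#                                   ≈⟨ ∑-cong (suc N) step ⟩
      ∑ (suc N) (λ n → φ (q ^ suc n) - φ (q ^ n)) ≈⟨ telescope (suc N) ⟩
      φ (q ^ suc N) - φ 1#                      ≈⟨ +-cong (trans (φ-cong (q^≈0 (ℕ.n≤1+n N))) (⟪0⟫ N)) (-‿cong φ1≈0) ⟩
      1# - 0#                                   ≈⟨ x-0#≈x 1# ⟩
      1#                                        ∎
      where
      telescope : ∀ n → ∑ n (λ k → φ (q ^ suc k) - φ (q ^ k)) ≈ φ (q ^ n) - φ 1#
      telescope zero    = sym (-‿inverseʳ _)
      telescope (suc n) = trans (+-congʳ (telescope n))
        (solve 3 (λ x y z → (x :- y) :+ (z :- x) := z :- y) refl (φ (q ^ n)) (φ 1#) (φ (q ^ suc n)))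

      step : ∀ n → T 0# 0# n ≈ φ (q ^ suc n) - φ (q ^ n)
      step n = begin
        T 0# 0# n
          ≈⟨ *-congˡ (*-cong (trans (⟪⟫-cong n (trans (*-congʳ (zeroˡ _)) (zeroˡ _))) (⟪0⟫ n))
               (*-congˡ (*-cong (trans (φ-cong (zeroˡ _)) (⟪0⟫ N)) (trans (φ-cong (zeroˡ _)) (⟪0⟫ N))))) ⟩
        q ^ n * (1# * (φ (q * q ^ n) * (1# * 1#)))
          ≈⟨ solve 2 (λ y f → y :* (con (+ 1) :* (f :* (con (+ 1) :* con (+ 1)))) := f :- (con (+ 1) :- y) :* f) refl (q ^ n) (φ (q * q ^ n)) ⟩
        φ (q ^ suc n) - (1# - q ^ n) * φ (q * q ^ n)
          ≈⟨ +-congˡ (-‿cong (φ-cons′ (q ^ n) (*-comm _ _))) ⟨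
        φ (q ^ suc n) - φ (q ^ n) ∎

    -- The product formula and its consequences

    module PartialTheta {M : ℕ} (N≤M : N ≤ M) where

      -- Every `M` with `N ≤ M` gives the same value modulo q^N. Keeping `M` free allows the sums to
      -- be as long as those on the right-hand side of the theorem.
      θ : Carrier → Carrier
      θ = P (suc M)

      θ-rec : ∀ b → θ b ≈ 1# - b * θ (b * q)
      θ-rec = P-rec N≤M

      θ-cong : ∀ {x y} → x ≈ y → θ x ≈ θ y
      θ-cong = P-cong (suc M)

      -- Both sides solve X(b) = 1 - b X(b q); the symmetry of `G` moves the functional equation
      -- from the first argument to the second.
      G0≈θ : ∀ b → G 0# b ≈ θ b
      G0≈θ = functional-eq-unique (G 0#) θ G0-rec θ-rec
        where
        G0-rec : ∀ b → G 0# b ≈ 1# - b * G 0# (b * q)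
        G0-rec b = begin
          G 0# b                        ≈⟨ G-sym 0# b ⟩
          G b 0#                        ≈⟨ G-functional-eq b 0# ⟩
          G 0# 0# - b * G (b * q) 0#    ≈⟨ +-cong G00≈1 (-‿cong (*-congˡ (G-sym (b * q) 0#))) ⟩
          1# - b * G 0# (b * q)         ∎

      -- As functions of `a`, both sides solve X(a) = θ(b) - a X(a q).
      G≈θθ : ∀ a b → G a b ≈ θ a * θ b
      G≈θθ a b = functional-eq-unique {θ b} (λ x → G x b) (λ x → θ x * θ b)
        (λ x → trans (G-functional-eq x b) (+-congʳ (G0≈θ b)))
        (λ x → trans (*-congʳ (θ-rec x))
          (solve 3 (λ x u v → (con (+ 1) :- x :* u) :* v := v :- x :* (u :* v)) refl x (θ (x * q)) (θ b)))
        a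

      -- At a = 1 the term with index 0 contains (1;q)_∞ = 0, so the sum may start at index 1.
      ∑T1 : ∀ b → ∑ N (λ n → T 1# b (suc n)) ≈ G 1# b
      ∑T1 b = sym (trans (∑-cons N _) (trans (+-congʳ T10≈0) (+-identityˡ _)))
        where
        T10≈0 : T 1# b 0 ≈ 0#
        T10≈0 = trans (T-zero 1# b) (trans (*-congʳ (-‿inverseʳ 1#)) (zeroˡ _))

      θ1 : θ 1# ≈ 1# - θ q
      θ1 = trans (θ-rec 1#) (+-congˡ (-‿cong (trans (*-identityˡ _) (θ-cong (*-identityˡ q)))))

      -- The summand of E(t) with index n + 1, since that series starts at 1.
      E : Carrier → ℕ → Carrier
      E t n = q ^ suc n * (⟪ t * q * q ^ suc n ⟫ n * (φ (q * q ^ suc n) * (φ (q ^ suc n) * φ (t * q * q ^ suc n))))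

      E-term : ∀ t n → T 1# (t * q) (suc n) - t * q * T q (t * q * q) n ≈ (1# - t) * E t n
      E-term t n = begin
        T 1# (t * q) (suc n) - t * q * T q (t * q * q) n
          ≈⟨ +-cong
               (*-congˡ (*-cong
                 (trans (⟪⟫-cons (1# * (t * q) * y) n) (*-cong (+-congˡ (-‿cong (*-congʳ (*-identityˡ _))))
                   (⟪⟫-cong n (solve 3 (λ t q y → con (+ 1) :* (t :* q) :* y :* q := t :* q :* (q :* y)) refl t q y))))
                 (*-congˡ (*-congʳ (φ-cong (*-identityˡ _))))))
               (-‿cong (*-congˡ (*-congˡ (*-cong
                 (trans (⟪⟫-cong n (solve 3 (λ t q z → q :* (t :* q :* q) :* z := t :* q :* q :* q :* z) refl t q (q ^ pred n)))
                   (trans (⟪⟫-pred n (t * q * q)) (⟪⟫-cong n (*-assoc (t * q) q y))))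
                 (*-cong (φ-cons′ (q * y) (*-comm _ _)) (*-congˡ (φ-cong (*-assoc (t * q) q y)))))))) ⟩
        q * y * ((1# - t * q * y) * V * (Q * (C * W))) - t * q * (y * (V * ((1# - q * y) * Q * (C * W))))
          -- The common products leave (1 - t q y) - t (1 - q y) = 1 - t.
          ≈⟨ solve 7 (λ t q y V Q C W →
               q :* y :* ((con (+ 1) :- t :* q :* y) :* V :* (Q :* (C :* W))) :- t :* q :* (y :* (V :* ((con (+ 1) :- q :* y) :* Q :* (C :* W))))
               := (con (+ 1) :- t) :* (q :* y :* (V :* (Q :* (C :* W))))) refl t q y V Q C W ⟩
        (1# - t) * E t n ∎
        where
        y = q ^ n
        V = ⟪ t * q * (q * y) ⟫ n
        Q = φ (q * (q * y))
        C = φ (q * y)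
        W = φ (t * q * (q * y))

      -- Warnaar's partial theta identity at a = 1, b = t q.
      ∑E : ∀ t → (1# - t) * ∑ N (E t) ≈ θ (t * q) - θ q
      ∑E t = begin
        (1# - t) * ∑ N (E t)
          ≈⟨ trans (∑-cong N (E-term t)) (∑-*ˡ N (1# - t) (E t)) ⟨
        ∑ N (λ n → T 1# (t * q) (suc n) - t * q * T q (t * q * q) n)
          ≈⟨ trans (∑-cong N (λ n → +-congˡ (-‿distribˡ-* _ _))) (trans (∑-+ N _ _) (+-congˡ (∑-*ˡ N (- (t * q)) _))) ⟩
        ∑ N (λ n → T 1# (t * q) (suc n)) + - (t * q) * ∑ N (T q (t * q * q))
          ≈⟨ +-cong (∑T1 (t * q)) (*-congˡ (sym (G-init q (t * q * q)))) ⟩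
        G 1# (t * q) + - (t * q) * G q (t * q * q)
          ≈⟨ +-cong (G≈θθ _ _) (*-congˡ (G≈θθ _ _)) ⟩
        θ 1# * θ (t * q) + - (t * q) * (θ q * θ (t * q * q))
          ≈⟨ +-cong (*-cong θ1 (θ-rec (t * q))) refl ⟩
        (1# - θ q) * (1# - t * q * θ (t * q * q)) + - (t * q) * (θ q * θ (t * q * q))
          ≈⟨ solve 4 (λ t q x z → (con (+ 1) :- x) :* (con (+ 1) :- t :* q :* z) :+ :- (t :* q) :* (x :* z)
                 := (con (+ 1) :- t :* q :* z) :- x) refl t q (θ q) (θ (t * q * q)) ⟩
        (1# - t * q * θ (t * q * q)) - θ q
          ≈⟨ +-congʳ (θ-rec (t * q)) ⟨
        θ (t * q) - θ q ∎
      -- The summand with index n + 1 of the generating function of D'.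
      d : ℕ → Carrier
      d n = q ^ suc n * q ^ suc n * (φ (q * q ^ suc n) * φ (q * q ^ suc n) * φ (q * q ^ suc n) * ⟪ q ^ suc n ⟫ suc n)

      -- With x = q^(n+1), write x² = x - x (1 - x). The factor 1 - x is absorbed into (x;q)_∞ in
      -- both parts, and a second one extends the finite product in the subtracted part.
      d-term : ∀ n → d n ≈ E 1# n - T 1# q (suc n)
      d-term n = begin
        d n
          ≈⟨ *-congˡ (*-congˡ (⟪⟫-cons (q * y) n)) ⟩
        x * x * (Q * Q * Q * ((1# - x) * V))
          ≈⟨ solve 3 (λ x V Q →
               x :* x :* (Q :* Q :* Q :* ((con (+ 1) :- x) :* V))
               := x :* (V :* (Q :* ((con (+ 1) :- x) :* Q :* Q))) :- x :* ((con (+ 1) :- x) :* V :* (Q :* ((con (+ 1) :- x) :* Q :* Q))))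
               refl x V Q ⟩
        x * (V * (Q * ((1# - x) * Q * Q))) - x * ((1# - x) * V * (Q * ((1# - x) * Q * Q)))
          ≈⟨ +-cong
               (*-congˡ (*-cong (⟪⟫-cong n (trans (*-congʳ (*-identityˡ q)) (*-comm _ _)))
                 (*-congˡ (*-cong φx (φ-cong (*-congʳ (*-identityˡ q)))))))
               (-‿cong (*-congˡ (*-cong
                 (trans (⟪⟫-cong (suc n) (*-congʳ (*-identityˡ q))) (⟪⟫-cons x n))
                 (*-congˡ (*-congʳ (trans (φ-cong (*-identityˡ _)) φx)))))) ⟨
        E 1# n - T 1# q (suc n) ∎
        where
        y = q ^ n
        x = q * y
        V = ⟪ x * q ⟫ n
        Q = φ (q * x)
        φx : φ x ≈ (1# - x) * Q
        φx = φ-cons′ x (*-comm _ _)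

      ∑d : ∑ N d ≈ ∑ N (E 1#) - (1# - θ q) * θ q
      ∑d = begin
        ∑ N d
          ≈⟨ ∑-cong N (λ n → trans (d-term n) (+-congˡ (sym (-1*x≈-x _)))) ⟩
        ∑ N (λ n → E 1# n + - 1# * T 1# q (suc n))
          ≈⟨ trans (∑-+ N _ _) (+-congˡ (trans (∑-*ˡ N _ _) (-1*x≈-x _))) ⟩
        ∑ N (E 1#) - ∑ N (λ n → T 1# q (suc n))
          ≈⟨ +-congˡ (-‿cong (trans (∑T1 q) (trans (G≈θθ 1# q) (*-congʳ θ1)))) ⟩
        ∑ N (E 1#) - (1# - θ q) * θ q ∎

-- At t = 1 + ε the identity ∑E becomes its derivative with respect to t at t = 1.
module Derivative {c ℓ} (R : CommutativeRing c ℓ) (q : CommutativeRing.Carrier R)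
                  (N : ℕ) (q^N≈0 : CommutativeRing._≈_ R (QSeries._^_ R q q N) (CommutativeRing.0# R))
                  {M : ℕ} (N≤M : N ≤ M) where
  open CommutativeRing R
  open QSeries R q
  open Truncated N q^N≈0
  open PartialTheta N≤M
  open IntegerCoefficients R
  open import Algebra.Properties.Semiring.Mult semiring using (_×_; ×-congʳ; ×-comm-*)
  open import Relation.Binary.Reasoning.Setoid setoid
  module ⋉ = Idealization ring TensorUnit.bimodule

  -- The dual numbers R[ε]/(ε²): a pair (x , x′) stands for x + x′ ε, and the second component of a
  -- product follows the Leibniz rule. In `𝔻` the base q is a constant.
  dual : CommutativeRing c ℓ
  dual = record
    { isCommutativeRing = record
      { isRing = ⋉.isRingᴺ
      ; *-comm = λ (x , x′) (y , y′) →
          *-comm x y , trans (+-comm _ _) (+-cong (*-comm x′ y) (*-comm x y′))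
      }
    }

  module 𝔻 = QSeries dual (q , 0#)

  -- Setting ε = 0 is a ring homomorphism, so the first component of every expression over the dual
  -- numbers is the same expression over `R`. The lemmas on `proj₁` below are instances.
  proj₁-^ : ∀ n → proj₁ ((q , 0#) 𝔻.^ n) ≈ q ^ n
  proj₁-^ zero    = refl
  proj₁-^ (suc n) = *-congˡ (proj₁-^ n)

  proj₂-^ : ∀ n → proj₂ ((q , 0#) 𝔻.^ n) ≈ 0#
  proj₂-^ zero    = refl
  proj₂-^ (suc n) = trans (+-cong (trans (*-congˡ (proj₂-^ n)) (zeroʳ q)) (zeroˡ _)) (+-identityʳ 0#)

  proj₁-⟪⟫ : ∀ n x {y} → proj₁ x ≈ y → proj₁ (𝔻.⟪ x ⟫ n) ≈ ⟪ y ⟫ n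
  proj₁-⟪⟫ zero    x eq = refl
  proj₁-⟪⟫ (suc n) x eq = *-cong (proj₁-⟪⟫ n x eq) (+-congˡ (-‿cong (*-cong eq (proj₁-^ n))))

  proj₁-∑ : ∀ n {f g} → (∀ i → proj₁ (f i) ≈ g i) → proj₁ (𝔻.∑ n f) ≈ ∑ n g
  proj₁-∑ zero    eq = refl
  proj₁-∑ (suc n) eq = +-cong (proj₁-∑ n eq) (eq n)

  proj₂-∑ : ∀ n {f g} → (∀ i → proj₂ (f i) ≈ g i) → proj₂ (𝔻.∑ n f) ≈ ∑ n g
  proj₂-∑ zero    eq = refl
  proj₂-∑ (suc n) eq = +-cong (proj₂-∑ n eq) (eq n)

  proj₁-s : ∀ n x {y} → proj₁ x ≈ y → proj₁ (𝔻.s n x) ≈ s n y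
  proj₁-s zero    x eq = refl
  proj₁-s (suc n) x eq = *-cong (-‿cong eq) (proj₁-s n _ (*-congʳ eq))

  -- For x = (1 + k ε) y one has s n x = (1 + k ε)ⁿ s n y, with ε-coefficient n k s n y. The case k
  -- = 1 serves t q with t = 1 + ε, and k = 0 serves the constant q.
  proj₂-s : ∀ n k x {y} → proj₁ x ≈ y → proj₂ x ≈ k * y → proj₂ (𝔻.s n x) ≈ n × (k * s n y)
  proj₂-s zero    k x eq₁ eq₂ = refl
  proj₂-s (suc n) k x@(x₁ , x₂) {y} eq₁ eq₂ = begin
    - x₁ * proj₂ (𝔻.s n xq) + - x₂ * proj₁ (𝔻.s n xq)
      ≈⟨ +-cong
           (*-cong (-‿cong eq₁) (proj₂-s n k xq xq₁ xq₂))
           (*-cong (-‿cong eq₂) (proj₁-s n xq xq₁)) ⟩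
    - y * (n × (k * s n (y * q))) + - (k * y) * s n (y * q)
      ≈⟨ +-cong
           (trans (×-comm-* n _ _) (×-congʳ n (solve 3 (λ k y z → :- y :* (k :* z) := k :* (:- y :* z)) refl k y (s n (y * q)))))
           (solve 3 (λ k y z → :- (k :* y) :* z := k :* (:- y :* z)) refl k y (s n (y * q))) ⟩
    n × (k * s (suc n) y) + k * s (suc n) y
      ≈⟨ +-comm _ _ ⟩
    suc n × (k * s (suc n) y) ∎
    where
    xq = CommutativeRing._*_ dual x (q , 0#)
    xq₁ : proj₁ xq ≈ y * q
    xq₁ = *-congʳ eq₁
    xq₂ : proj₂ xq ≈ k * (y * q)
    xq₂ = trans (+-cong (zeroʳ x₁) (*-congʳ eq₂)) (trans (+-identityˡ _) (*-assoc k y q))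

  module 𝕋 = 𝔻.Truncated N (trans (proj₁-^ N) q^N≈0 , proj₂-^ N)
  module ℙ = 𝕋.PartialTheta N≤M

  proj₁-E : ∀ n → proj₁ (ℙ.E (1# , 1#) n) ≈ E 1# n
  proj₁-E n = *-cong q^≈ (*-cong (proj₁-⟪⟫ n _ (*-congˡ q^≈)) (*-cong (proj₁-⟪⟫ N _ (*-congˡ q^≈))
    (*-cong (proj₁-⟪⟫ N _ q^≈) (proj₁-⟪⟫ N _ (*-congˡ q^≈)))))
    where
    q^≈ : proj₁ ((q , 0#) 𝔻.^ suc n) ≈ q ^ suc n
    q^≈ = proj₁-^ (suc n)

  ∑E1 : ∑ N (E 1#) ≈ - ∑ (suc M) (λ n → n × s n q)
  ∑E1 = begin
    ∑ N (E 1#)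
      ≈⟨ proj₁-∑ N proj₁-E ⟨
    proj₁ (𝔻.∑ N (ℙ.E (1# , 1#)))
      -- At t = 1 + ε the factor 1 - t is - ε, so the ε-coefficient of the left side of `ℙ.∑E` is
      -- minus the first component of the sum.
      ≈⟨ solve 2 (λ x y → x := :- ((con (+ 1) :- con (+ 1)) :* y :+ (con (+ 0) :- con (+ 1)) :* x)) refl _ _ ⟩
    - ((1# - 1#) * proj₂ (𝔻.∑ N (ℙ.E (1# , 1#))) + (0# - 1#) * proj₁ (𝔻.∑ N (ℙ.E (1# , 1#))))
      ≈⟨ -‿cong (proj₂ (ℙ.∑E (1# , 1#))) ⟩
    - (proj₂ (ℙ.θ _) - proj₂ (ℙ.θ (q , 0#)))
      ≈⟨ -‿cong (+-cong
           (proj₂-∑ (suc M) (λ n → trans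
             (proj₂-s n 1# _ (*-identityˡ q) (trans (+-congʳ (zeroʳ 1#)) (+-identityˡ _)))
             (×-congʳ n (*-identityˡ _))))
           (-‿cong (trans (proj₂-∑ (suc M) {g = λ _ → 0#} (λ n → trans
             (proj₂-s n 0# (q , 0#) refl (sym (zeroˡ q)))
             (trans (×-congʳ n (zeroˡ _)) (×-homo-0# n)))) (∑-zero (suc M))))) ⟩
    - (∑ (suc M) (λ n → n × s n q) - 0#)
      ≈⟨ -‿cong (x-0#≈x _) ⟩
    - ∑ (suc M) (λ n → n × s n q) ∎
    where
    ×-homo-0# : ∀ n → n × 0# ≈ 0#
    ×-homo-0# zero    = refl
    ×-homo-0# (suc n) = trans (+-identityˡ _) (×-homo-0# n)

    ∑-zero : ∀ n → ∑ n (λ _ → 0#) ≈ 0#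
    ∑-zero zero    = refl
    ∑-zero (suc n) = trans (+-identityʳ _) (∑-zero n)

  -- The term - θ(q) contained in - (1 - θ(q)) θ(q) raises every weight n from `∑E1` to n + 1.
  ∑d-closed : ∑ N d ≈ θ q * θ q - ∑ (suc M) (λ n → suc n × s n q)
  ∑d-closed = begin
    ∑ N d
      ≈⟨ ∑d ⟩
    ∑ N (E 1#) - (1# - θ q) * θ q
      ≈⟨ +-congʳ ∑E1 ⟩
    - ∑ (suc M) (λ n → n × s n q) - (1# - θ q) * θ q
      ≈⟨ solve 2 (λ x y → :- x :- (con (+ 1) :- y) :* y := y :* y :- (y :+ x)) refl _ _ ⟩
    θ q * θ q - (θ q + ∑ (suc M) (λ n → n × s n q))
      ≈⟨ +-congˡ (-‿cong (∑-+ (suc M) _ _)) ⟨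
    θ q * θ q - ∑ (suc M) (λ n → suc n × s n q) ∎

-- Power series modulo q^N

module _ where
  open import Data.Integer.Base using (_+_; _*_; _-_; -_)
  open ≡ using (refl; sym; trans; cong; cong₂; module ≡-Reasoning)
  open ≡-Reasoning

  -- Finite sums and monomials

  sumℤ-cong< : ∀ n {a b : ℕ → ℤ} → (∀ i → i < n → a i ≡ b i) → sumℤ n a ≡ sumℤ n b
  sumℤ-cong< zero    eq = refl
  sumℤ-cong< (suc n) eq = cong₂ _+_ (sumℤ-cong< n (λ i i<n → eq i (ℕ.m<n⇒m<1+n i<n))) (eq n ℕ.≤-refl)

  sumℤ-cong : ∀ n {a b : ℕ → ℤ} → (∀ i → a i ≡ b i) → sumℤ n a ≡ sumℤ n b
  sumℤ-cong n eq = sumℤ-cong< n (λ i _ → eq i)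

  sumℤ-≡0 : ∀ n {a : ℕ → ℤ} → (∀ i → i < n → a i ≡ + 0) → sumℤ n a ≡ + 0
  sumℤ-≡0 zero    eq = refl
  sumℤ-≡0 (suc n) eq = cong₂ _+_ (sumℤ-≡0 n (λ i i<n → eq i (ℕ.m<n⇒m<1+n i<n))) (eq n ℕ.≤-refl)

  sumℤ-cons : ∀ n (a : ℕ → ℤ) → sumℤ (suc n) a ≡ a 0 + sumℤ n (a ∘ suc)
  sumℤ-cons zero    a = ℤ.+-comm (+ 0) (a 0)
  sumℤ-cons (suc n) a = trans (cong (_+ a (suc n)) (sumℤ-cons n a)) (ℤ.+-assoc (a 0) _ _)

  sumℤ-+ : ∀ n (a b : ℕ → ℤ) → sumℤ n (λ i → a i + b i) ≡ sumℤ n a + sumℤ n b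
  sumℤ-+ zero    a b = refl
  sumℤ-+ (suc n) a b = trans (cong (_+ (a n + b n)) (sumℤ-+ n a b)) (lemma (sumℤ n a) (sumℤ n b) (a n) (b n))
    where
    lemma : ∀ x y z w → x + y + (z + w) ≡ x + z + (y + w)
    lemma = solve-∀

  sumℤ-*ˡ : ∀ n c (a : ℕ → ℤ) → sumℤ n (λ i → c * a i) ≡ c * sumℤ n a
  sumℤ-*ˡ zero    c a = sym (ℤ.*-zeroʳ c)
  sumℤ-*ˡ (suc n) c a = trans (cong (_+ c * a n) (sumℤ-*ˡ n c a)) (sym (ℤ.*-distribˡ-+ c _ _))

  sumℤ-stable : ∀ {m n} (a : ℕ → ℤ) → m ≤ n → (∀ i → m ≤ i → a i ≡ + 0) → sumℤ n a ≡ sumℤ m a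
  sumℤ-stable {m} a m≤n a≡0 with ℕ.m≤n⇒m<n∨m≡n m≤n
  ... | inj₂ refl = refl
  sumℤ-stable {m} {suc n} a m≤n a≡0 | inj₁ (s≤s m≤n′) =
    trans (cong₂ _+_ (sumℤ-stable a m≤n′ a≡0) (a≡0 n m≤n′)) (ℤ.+-identityʳ _)

  sumPS-coeff : ∀ k F n → sumPS k F n ≡ sumℤ k (λ i → F i n)
  sumPS-coeff zero    F n = refl
  sumPS-coeff (suc k) F n = cong (_+ F k n) (sumPS-coeff k F n)

  mono-≡ : ∀ c {e n} → n ≡ e → mono c e n ≡ c
  mono-≡ c {e} {n} n≡e with n ℕ.≟ e
  ... | yes _   = refl
  ... | no  n≢e = contradiction n≡e n≢e

  mono-≢ : ∀ c {e n} → n ≢ e → mono c e n ≡ + 0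
  mono-≢ c {e} {n} n≢e with n ℕ.≟ e
  ... | yes n≡e = contradiction n≡e n≢e
  ... | no  _   = refl

  mono-reindex : ∀ c {e n e′ n′} → (n ≡ e → n′ ≡ e′) → (n′ ≡ e′ → n ≡ e) → mono c e n ≡ mono c e′ n′
  mono-reindex c {e} {n} to from with n ℕ.≟ e
  ... | yes n≡e = sym (mono-≡ c (to n≡e))
  ... | no  n≢e = sym (mono-≢ c (n≢e ∘ from))

  mono-map : ∀ (h : ℤ → ℤ) → h (+ 0) ≡ + 0 → ∀ c e n → h (mono c e n) ≡ mono (h c) e n
  mono-map h h0 c e n with n ℕ.≟ e
  ... | yes _ = refl
  ... | no  _ = h0

  -- The Cauchy product

  tail : PS → PS
  tail f n = f (suc n)

  tail-mono : ∀ c e n → tail (mono c (suc e)) n ≡ mono c e n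
  tail-mono c e n = mono-reindex c ℕ.suc-injective (cong suc)

  ⊛-cong≤ : ∀ n {f f′ g g′} → (∀ k → k ≤ n → f k ≡ f′ k) → (∀ k → k ≤ n → g k ≡ g′ k) →
            (f ⊛ g) n ≡ (f′ ⊛ g′) n
  ⊛-cong≤ n f≡ g≡ = sumℤ-cong< (suc n) (λ { k (s≤s k≤n) → cong₂ _*_ (f≡ k k≤n) (g≡ (n ∸ k) (ℕ.m∸n≤m n k)) })

  ⊛-congˡ : ∀ n {f f′} g → (∀ k → f k ≡ f′ k) → (f ⊛ g) n ≡ (f′ ⊛ g) n
  ⊛-congˡ n g f≡ = ⊛-cong≤ n {g = g} (λ k _ → f≡ k) (λ _ _ → refl)

  ⊛-suc : ∀ n f g → (f ⊛ g) (suc n) ≡ f 0 * g (suc n) + (tail f ⊛ g) n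
  ⊛-suc n f g = sumℤ-cons (suc n) _

  ⊛-sucʳ : ∀ n f g → (f ⊛ g) (suc n) ≡ (f ⊛ tail g) n + f (suc n) * g 0
  ⊛-sucʳ n f g = cong₂ _+_
    (sumℤ-cong< (suc n) (λ { k (s≤s k≤n) → cong (λ j → f k * g j) (ℕ.+-∸-assoc 1 k≤n) }))
    (cong (λ j → f (suc n) * g j) (ℕ.n∸n≡0 n))

  -- Exchanging the factors turns the recursion `⊛-suc` on the first one into the recursion `⊛-sucʳ`
  -- on the second.
  ⊛-comm : ∀ n f g → (f ⊛ g) n ≡ (g ⊛ f) n
  ⊛-comm zero    f g = cong (λ x → + 0 + x) (ℤ.*-comm (f 0) (g 0))
  ⊛-comm (suc n) f g = begin
    (f ⊛ g) (suc n)                       ≡⟨ ⊛-suc n f g ⟩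
    f 0 * g (suc n) + (tail f ⊛ g) n      ≡⟨ cong₂ _+_ (ℤ.*-comm (f 0) _) (⊛-comm n (tail f) g) ⟩
    g (suc n) * f 0 + (g ⊛ tail f) n      ≡⟨ ℤ.+-comm (g (suc n) * f 0) _ ⟩
    (g ⊛ tail f) n + g (suc n) * f 0      ≡⟨ ⊛-sucʳ n g f ⟨
    (g ⊛ f) (suc n)                       ∎

  ⊛-distribʳ : ∀ n h f g → ((f ⊕ g) ⊛ h) n ≡ (f ⊛ h) n + (g ⊛ h) n
  ⊛-distribʳ n h f g = trans
    (sumℤ-cong (suc n) (λ k → ℤ.*-distribʳ-+ (h (n ∸ k)) (f k) (g k)))
    (sumℤ-+ (suc n) _ _)

  ⊛-scaleˡ : ∀ n c f g → (scale c f ⊛ g) n ≡ c * (f ⊛ g) n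
  ⊛-scaleˡ n c f g = trans (sumℤ-cong (suc n) (λ k → ℤ.*-assoc c (f k) _)) (sumℤ-*ˡ (suc n) c _)

  -- Induction on the coefficient, for all series at once: the tail of f ⊛ g is f 0 times the tail
  -- of g plus tail f ⊛ g, and the induction hypothesis applies to the latter.
  ⊛-assoc : ∀ n f g h → ((f ⊛ g) ⊛ h) n ≡ (f ⊛ (g ⊛ h)) n
  ⊛-assoc zero    f g h = lemma (f 0) (g 0) (h 0)
    where
    lemma : ∀ x y z → + 0 + (+ 0 + x * y) * z ≡ + 0 + x * (+ 0 + y * z)
    lemma = solve-∀
  ⊛-assoc (suc n) f g h = begin
    ((f ⊛ g) ⊛ h) (suc n)
      ≡⟨ ⊛-suc n (f ⊛ g) h ⟩
    (f ⊛ g) 0 * h (suc n) + (tail (f ⊛ g) ⊛ h) n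
      ≡⟨ cong (λ x → (f ⊛ g) 0 * h (suc n) + x) (trans (⊛-congˡ n h (λ k → ⊛-suc k f g)) (⊛-distribʳ n h (scale (f 0) (tail g)) (tail f ⊛ g))) ⟩
    (f ⊛ g) 0 * h (suc n) + ((scale (f 0) (tail g) ⊛ h) n + ((tail f ⊛ g) ⊛ h) n)
      ≡⟨ cong (λ x → (f ⊛ g) 0 * h (suc n) + x) (cong₂ _+_ (⊛-scaleˡ n (f 0) (tail g) h) (⊛-assoc n (tail f) g h)) ⟩
    (+ 0 + f 0 * g 0) * h (suc n) + (f 0 * (tail g ⊛ h) n + (tail f ⊛ (g ⊛ h)) n)
      ≡⟨ lemma (f 0) (g 0) (h (suc n)) _ _ ⟩
    f 0 * (g 0 * h (suc n) + (tail g ⊛ h) n) + (tail f ⊛ (g ⊛ h)) n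
      ≡⟨ cong (λ x → f 0 * x + (tail f ⊛ (g ⊛ h)) n) (⊛-suc n g h) ⟨
    f 0 * (g ⊛ h) (suc n) + (tail f ⊛ (g ⊛ h)) n
      ≡⟨ ⊛-suc n f (g ⊛ h) ⟨
    (f ⊛ (g ⊛ h)) (suc n) ∎
    where
    lemma : ∀ x y z v w → (+ 0 + x * y) * z + (x * v + w) ≡ x * (y * z + v) + w
    lemma = solve-∀

  mono0-⊛ : ∀ c n f → (mono c 0 ⊛ f) n ≡ c * f n
  mono0-⊛ c zero    f = ℤ.+-identityˡ _
  mono0-⊛ c (suc n) f = trans (⊛-suc n (mono c 0) f)
    (trans (cong (λ x → c * f (suc n) + x) (sumℤ-≡0 (suc n) (λ _ _ → refl))) (ℤ.+-identityʳ _))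

  mono-suc-⊛ : ∀ c e n f → (mono c (suc e) ⊛ f) (suc n) ≡ (mono c e ⊛ f) n
  mono-suc-⊛ c e n f = trans (⊛-suc n (mono c (suc e)) f)
    (trans (ℤ.+-identityˡ _) (⊛-congˡ n f (tail-mono c e)))

  mono-⊛-mono : ∀ c d e f n → (mono c e ⊛ mono d f) n ≡ mono (c * d) (e ℕ.+ f) n
  mono-⊛-mono c d zero    f n       = trans (mono0-⊛ c n (mono d f)) (mono-map (c *_) (ℤ.*-zeroʳ c) d f n)
  mono-⊛-mono c d (suc e) f zero    = refl
  mono-⊛-mono c d (suc e) f (suc n) = trans (mono-suc-⊛ c e n (mono d f))
    (trans (mono-⊛-mono c d e f n) (sym (tail-mono (c * d) (e ℕ.+ f) n)))

-- The quotient of ℤ[[q]] by q^N, as a setoid: the series stay as they are and equality compares the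
-- first `N` coefficients. Products respect it because coefficient n involves only coefficients up
-- to n.
PS/q^ : ℕ → CommutativeRing _ _
PS/q^ N = record
  { Carrier = PS
  ; _≈_ = λ f g → ∀ k → k < N → f k ≡ g k
  ; _+_ = _⊕_
  ; _*_ = _⊛_
  ; -_ = λ f k → ℤ.- f k
  ; 0# = λ _ → + 0
  ; 1# = one
  ; isCommutativeRing = record
    { isRing = record
      { +-isAbelianGroup = record
        { isGroup = record
          { isMonoid = record
            { isSemigroup = record
              { isMagma = record
                { isEquivalence = record
                  { refl  = λ _ _ → ≡.refl
                  ; sym   = λ f≈g k k<N → ≡.sym (f≈g k k<N)
                  ; trans = λ f≈g g≈h k k<N → ≡.trans (f≈g k k<N) (g≈h k k<N)
                  }
                ; ∙-cong = λ f≈ g≈ k k<N → ≡.cong₂ ℤ._+_ (f≈ k k<N) (g≈ k k<N)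
                }
              ; assoc = λ f g h k _ → ℤ.+-assoc (f k) (g k) (h k)
              }
            ; identity = (λ f k _ → ℤ.+-identityˡ (f k)) , (λ f k _ → ℤ.+-identityʳ (f k))
            }
          ; inverse = (λ f k _ → ℤ.+-inverseˡ (f k)) , (λ f k _ → ℤ.+-inverseʳ (f k))
          ; ⁻¹-cong = λ f≈ k k<N → ≡.cong ℤ.-_ (f≈ k k<N)
          }
        ; comm = λ f g k _ → ℤ.+-comm (f k) (g k)
        }
      ; *-cong = λ f≈ g≈ n n<N → ⊛-cong≤ n (λ k k≤n → f≈ k (ℕ.≤-<-trans k≤n n<N)) (λ k k≤n → g≈ k (ℕ.≤-<-trans k≤n n<N))
      ; *-assoc = λ f g h n _ → ⊛-assoc n f g h
      ; *-identity = (λ f n _ → identityˡ f n) , (λ f n _ → ≡.trans (⊛-comm n f one) (identityˡ f n))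
      ; distrib = (λ h f g n _ → ≡.trans (⊛-comm n h (f ⊕ g)) (≡.trans (⊛-distribʳ n h f g) (≡.cong₂ ℤ._+_ (⊛-comm n f h) (⊛-comm n g h))))
                , (λ h f g n _ → ⊛-distribʳ n h f g)
      }
    ; *-comm = λ f g n _ → ⊛-comm n f g
    }
  }
  where
  identityˡ : ∀ f n → (one ⊛ f) n ≡ f n
  identityˡ f n = ≡.trans (mono0-⊛ (+ 1) n f) (ℤ.*-identityˡ (f n))

q : PS
q = mono (+ 1) 1

-- The closed form is k n + n (n - 1) / 2.
exponent : ℕ → ℕ → ℕ
exponent zero    k = 0
exponent (suc n) k = k ℕ.+ exponent n (suc k)

module ModuloPower (N : ℕ) where
  open CommutativeRing (PS/q^ N)
  open QSeries (PS/q^ N) q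
  open import Relation.Binary.Reasoning.Setoid setoid
  open import Algebra.Properties.Semiring.Mult semiring using () renaming (_×_ to _×ₙ_)

  pointwise : ∀ {f g : PS} → (∀ k → f k ≡ g k) → f ≈ g
  pointwise eq k _ = eq k

  q^≈mono : ∀ n → q ^ n ≈ mono (+ 1) n
  q^≈mono zero    = refl
  q^≈mono (suc n) = trans (*-congˡ {q} (q^≈mono n)) (pointwise (mono-⊛-mono (+ 1) (+ 1) 1 n))

  mono≈0 : ∀ {c e} → N ≤ e → mono c e ≈ 0#
  mono≈0 {c} N≤e k k<N = mono-≢ c (ℕ.<⇒≢ (ℕ.<-≤-trans k<N N≤e))

  q^N≈0 : q ^ N ≈ 0#
  q^N≈0 = trans (q^≈mono N) (mono≈0 ℕ.≤-refl)

  open Truncated N q^N≈0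

  poch≈⟪⟫ : ∀ m n → poch m n ≈ ⟪ q ^ m ⟫ n
  poch≈⟪⟫ m zero    = refl
  poch≈⟪⟫ m (suc n) = *-cong (poch≈⟪⟫ m n) (+-congˡ {one} (-‿cong (begin
    mono (+ 1) (m ℕ.+ n)  ≈⟨ q^≈mono (m ℕ.+ n) ⟨
    q ^ (m ℕ.+ n)         ≈⟨ ^-homo-* q m n ⟩
    q ^ m * q ^ n         ∎)))
    where open import Algebra.Properties.Semiring.Exp semiring using (^-homo-*)

  poch-stable : ∀ m d → poch (suc m) (N ℕ.+ d) ≈ poch (suc m) N
  poch-stable m zero rewrite ℕ.+-identityʳ N = refl
  poch-stable m (suc d) rewrite ℕ.+-suc N d = begin
    poch (suc m) (N ℕ.+ d) * oneMinusQ (suc m ℕ.+ (N ℕ.+ d))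
      ≈⟨ *-cong (poch-stable m d) (+-congˡ {one} (-‿cong (mono≈0 (ℕ.≤-trans (ℕ.m≤m+n N d) (ℕ.m≤n+m _ (suc m)))))) ⟩
    poch (suc m) N * (1# - 0#)
      ≈⟨ *-congˡ {poch (suc m) N} (x-0#≈x 1#) ⟩
    poch (suc m) N * 1#
      ≈⟨ *-identityʳ (poch (suc m) N) ⟩
    poch (suc m) N ∎

  neg-mono-⊛-mono : ∀ c e f → - mono (+ 1) e * mono c f ≈ mono (ℤ.- c) (e ℕ.+ f)
  neg-mono-⊛-mono c e f = begin
    - mono (+ 1) e * mono c f         ≈⟨ -‿distribˡ-* (mono (+ 1) e) (mono c f) ⟨
    - (mono (+ 1) e * mono c f)       ≈⟨ -‿cong (pointwise (mono-⊛-mono (+ 1) c e f)) ⟩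
    - mono (+ 1 ℤ.* c) (e ℕ.+ f)      ≈⟨ pointwise (mono-map ℤ.-_ ≡.refl (+ 1 ℤ.* c) (e ℕ.+ f)) ⟩
    mono (ℤ.- (+ 1 ℤ.* c)) (e ℕ.+ f)  ≈⟨ pointwise (λ k → ≡.cong (λ x → mono (ℤ.- x) (e ℕ.+ f) k) (ℤ.*-identityˡ c)) ⟩
    mono (ℤ.- c) (e ℕ.+ f)            ∎
    where open import Algebra.Properties.Ring ring using (-‿distribˡ-*)

  -- The power k varies because the recursion of `s` passes from b to b q; `exponent` follows the
  -- same recursion.
  s≈mono : ∀ n k {b} → b ≈ mono (+ 1) k → s n b ≈ mono (signPow n) (exponent n k)
  s≈mono zero    k     b≈ = refl
  s≈mono (suc n) k {b} b≈ = trans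
    (*-cong (-‿cong b≈) (s≈mono n (suc k) {b * q} (begin
      b * q               ≈⟨ *-congʳ {q} b≈ ⟩
      mono (+ 1) k * q    ≈⟨ *-comm (mono (+ 1) k) q ⟩
      q * mono (+ 1) k    ≈⟨ pointwise (mono-⊛-mono (+ 1) (+ 1) 1 k) ⟩
      mono (+ 1) (suc k)  ∎)))
    (neg-mono-⊛-mono (signPow n) k (exponent n (suc k)))

  ∑-coeff : ∀ n F k → ∑ n F k ≡ sumℤ n (λ i → F i k)
  ∑-coeff zero    F k = ≡.refl
  ∑-coeff (suc n) F k = ≡.cong (ℤ._+ F n k) (∑-coeff n F k)

  ×-coeff : ∀ n f k → (n ×ₙ f) k ≡ (+ n) ℤ.* f k
  ×-coeff zero    f k = ≡.sym (ℤ.*-zeroˡ (f k))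
  ×-coeff (suc n) f k = ≡.trans (≡.cong (λ x → f k ℤ.+ x) (×-coeff n f k)) (lemma (+ n) (f k))
    where
    lemma : ∀ m x → x ℤ.+ m ℤ.* x ≡ (+ 1 ℤ.+ m) ℤ.* x
    lemma = solve-∀

-- Coefficient k of `pochInf` is taken from k + 1 factors, and `φ` has `N` of them. Working modulo
-- q^(k+1) for each k separately shows that the additional factors do not change it.
pochInf≈φ : ∀ N m → CommutativeRing._≈_ (PS/q^ N) (pochInf (suc m)) (QSeries.⟪_⟫_ (PS/q^ N) q (QSeries._^_ (PS/q^ N) q q (suc m)) N)
pochInf≈φ N m k k<N = ≡.trans (≡.sym coeff-stable) (ModuloPower.poch≈⟪⟫ N (suc m) N k k<N)
  where
  coeff-stable : poch (suc m) N k ≡ pochInf (suc m) k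
  coeff-stable with d , ≡.refl ← ℕ.m≤n⇒∃[o]m+o≡n k<N = ModuloPower.poch-stable (suc k) m d k ℕ.≤-refl

-- The coefficients of the generating function of D'

D'-term : ℕ → PS
D'-term i = let n = suc i in shift (2 ℕ.* n) (cube (pochInf (suc n)) ⊛ poch n n)

D'-sum : ∀ n → D' n ≡ sumℤ (suc n) (λ i → D'-term i n)
D'-sum n = sumPS-coeff (suc n) D'-term n

module _ (n : ℕ) {M : ℕ} (n<M : n < M) where
  private
    -- The least precision at which coefficient n is visible; it is also the number of summands that
    -- define `D' n`.
    N = suc n
  open CommutativeRing (PS/q^ N) using (_≈_; refl; trans; *-cong)
  open QSeries (PS/q^ N) q
  open ModuloPower N
  open Truncated N q^N≈0
  open PartialTheta n<M
  open Derivative (PS/q^ N) q N q^N≈0 n<M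
  open import Algebra.Properties.Semiring.Mult (CommutativeRing.semiring (PS/q^ N)) using () renaming (_×_ to _×ₙ_)

  D'-term≈d : ∀ i → D'-term i ≈ d i
  D'-term≈d i = *-cong
    {mono (+ 1) (2 ℕ.* suc i)} {q ^ suc i ⊛ q ^ suc i}
    {cube (pochInf (suc (suc i))) ⊛ poch (suc i) (suc i)}
    (λ k k<N → ≡.trans (≡.cong (λ e → mono (+ 1) e k) (≡.cong (suc i ℕ.+_) (ℕ.+-identityʳ (suc i))))
      (≡.trans (≡.sym (mono-⊛-mono (+ 1) (+ 1) (suc i) (suc i) k))
        (≡.sym (*-cong {q ^ suc i} (q^≈mono (suc i)) (q^≈mono (suc i)) k k<N))))
    (*-cong {cube (pochInf (suc (suc i)))}
      (*-cong {pochInf (suc (suc i)) ⊛ pochInf (suc (suc i))} (*-cong {pochInf (suc (suc i))} φ≈ φ≈) φ≈) (poch≈⟪⟫ (suc i) (suc i)))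
    where
    φ≈ = pochInf≈φ N (suc i)

  term : ℕ → PS
  term i = mono (signPow i) (exponent i 1)

  s≈term : ∀ i → s i q ≈ term i
  s≈term i = s≈mono i 1 {q} refl

  θθ-coeff : (θ q ⊛ θ q) n ≡ sumℤ (suc M) (λ r → sumℤ (suc M) (λ t →
               mono (signPow r ℤ.* signPow t) (exponent r 1 ℕ.+ exponent t 1) n))
  θθ-coeff = begin
    (θ q ⊛ θ q) n
      ≡⟨ *-cong {θ q} (∑-cong (suc M) s≈term) (∑-cong (suc M) s≈term) n ℕ.≤-refl ⟩
    (∑ (suc M) term ⊛ ∑ (suc M) term) n
      ≡⟨ ∑-*ʳ (suc M) (∑ (suc M) term) term n ℕ.≤-refl ⟨
    ∑ (suc M) (λ r → term r ⊛ ∑ (suc M) term) n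
      ≡⟨ ∑-cong (suc M) (λ r → CommutativeRing.sym (PS/q^ N) {∑ (suc M) (λ t → term r ⊛ term t)} (∑-*ˡ (suc M) (term r) term)) n ℕ.≤-refl ⟩
    ∑ (suc M) (λ r → ∑ (suc M) (λ t → term r ⊛ term t)) n
      ≡⟨ ∑-coeff (suc M) _ n ⟩
    sumℤ (suc M) (λ r → ∑ (suc M) (λ t → term r ⊛ term t) n)
      ≡⟨ sumℤ-cong (suc M) (λ r → ≡.trans (∑-coeff (suc M) _ n)
           (sumℤ-cong (suc M) (λ t → mono-⊛-mono (signPow r) (signPow t) (exponent r 1) (exponent t 1) n))) ⟩
    _ ∎
    where open ≡.≡-Reasoning

  D'-coeff : D' n ≡ sumℤ (suc M) (λ r → sumℤ (suc M) (λ t →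
                      mono (signPow r ℤ.* signPow t) (exponent r 1 ℕ.+ exponent t 1) n))
                  ℤ.- sumℤ (suc M) (λ i → mono (signPow i ℤ.* + suc i) (exponent i 1) n)
  D'-coeff = begin
    D' n
      ≡⟨ ≡.trans (D'-sum n) (≡.sym (∑-coeff N D'-term n)) ⟩
    ∑ N D'-term n
      ≡⟨ ∑-cong N D'-term≈d n ℕ.≤-refl ⟩
    ∑ N d n
      ≡⟨ ∑d-closed n ℕ.≤-refl ⟩
    (θ q ⊛ θ q) n ℤ.- ∑ (suc M) (λ i → suc i ×ₙ s i q) n
      ≡⟨ ≡.cong₂ ℤ._-_ θθ-coeff (≡.trans (∑-coeff (suc M) _ n) (sumℤ-cong (suc M) weighted)) ⟩
    _ ∎
    where
    open ≡.≡-Reasoning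
    weighted : ∀ i → (suc i ×ₙ s i q) n ≡ mono (signPow i ℤ.* + suc i) (exponent i 1) n
    weighted i = begin
      (suc i ×ₙ s i q) n          ≡⟨ ×-coeff (suc i) (s i q) n ⟩
      + suc i ℤ.* s i q n         ≡⟨ ≡.cong (λ x → + suc i ℤ.* x) (s≈term i n ℕ.≤-refl) ⟩
      + suc i ℤ.* term i n        ≡⟨ mono-map (λ x → + suc i ℤ.* x) (ℤ.*-zeroʳ (+ suc i)) (signPow i) (exponent i 1) n ⟩
      mono (+ suc i ℤ.* signPow i) (exponent i 1) n ≡⟨ ≡.cong (λ c → mono c (exponent i 1) n) (ℤ.*-comm (+ suc i) (signPow i)) ⟩
      mono (signPow i ℤ.* + suc i) (exponent i 1) n ∎

-- Comparison of coefficients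

module _ where
  open import Data.Integer.Base using (_+_; _*_; _-_; -_)
  open ≡ using (refl; sym; trans; cong; cong₂; module ≡-Reasoning)
  open ≡-Reasoning

  -- Exponents, signs and symmetric sums

  exponent-closed : ∀ n k → 2 ℕ.* exponent n k ℕ.+ n ≡ n ℕ.* (2 ℕ.* k ℕ.+ n)
  exponent-closed zero    k = refl
  exponent-closed (suc n) k = begin
    2 ℕ.* (k ℕ.+ exponent n (suc k)) ℕ.+ suc n               ≡⟨ split k (exponent n (suc k)) n ⟩
    (2 ℕ.* exponent n (suc k) ℕ.+ n) ℕ.+ (2 ℕ.* k ℕ.+ 1)     ≡⟨ cong (ℕ._+ (2 ℕ.* k ℕ.+ 1)) (exponent-closed n (suc k)) ⟩
    n ℕ.* (2 ℕ.* suc k ℕ.+ n) ℕ.+ (2 ℕ.* k ℕ.+ 1)            ≡⟨ join n k ⟩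
    suc n ℕ.* (2 ℕ.* k ℕ.+ suc n)                            ∎
    where
    split : ∀ k e n → 2 ℕ.* (k ℕ.+ e) ℕ.+ suc n ≡ (2 ℕ.* e ℕ.+ n) ℕ.+ (2 ℕ.* k ℕ.+ 1)
    split = ℕSolver.solve-∀
    join : ∀ n k → n ℕ.* (2 ℕ.* suc k ℕ.+ n) ℕ.+ (2 ℕ.* k ℕ.+ 1) ≡ suc n ℕ.* (2 ℕ.* k ℕ.+ suc n)
    join = ℕSolver.solve-∀

  -- `exponent i 1` is the triangular number i (i + 1) / 2. This is the source of the substitution q
  -- ↦ q⁸ in the theorem. Adding 4 i to both sides allows `exponent-closed` to be used without
  -- subtraction.
  sq-odd : ∀ i → sq (2 ℕ.* i ℕ.+ 1) ≡ 8 ℕ.* exponent i 1 ℕ.+ 1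
  sq-odd i = ℕ.+-cancelʳ-≡ (4 ℕ.* i) _ _ (begin
    sq (2 ℕ.* i ℕ.+ 1) ℕ.+ 4 ℕ.* i                  ≡⟨ left i ⟩
    4 ℕ.* (i ℕ.* (2 ℕ.* 1 ℕ.+ i)) ℕ.+ 1             ≡⟨ cong (λ x → 4 ℕ.* x ℕ.+ 1) (exponent-closed i 1) ⟨
    4 ℕ.* (2 ℕ.* exponent i 1 ℕ.+ i) ℕ.+ 1          ≡⟨ right (exponent i 1) i ⟩
    8 ℕ.* exponent i 1 ℕ.+ 1 ℕ.+ 4 ℕ.* i            ∎)
    where
    left : ∀ i → (2 ℕ.* i ℕ.+ 1) ℕ.* (2 ℕ.* i ℕ.+ 1) ℕ.+ 4 ℕ.* i ≡ 4 ℕ.* (i ℕ.* (2 ℕ.* 1 ℕ.+ i)) ℕ.+ 1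
    left = ℕSolver.solve-∀
    right : ∀ e i → 4 ℕ.* (2 ℕ.* e ℕ.+ i) ℕ.+ 1 ≡ 8 ℕ.* e ℕ.+ 1 ℕ.+ 4 ℕ.* i
    right = ℕSolver.solve-∀

  -- Growth of the exponents, used to discard the terms beyond the truncation.
  n≤exponent : ∀ n k → n ≤ exponent n (suc k)
  n≤exponent zero    k = z≤n
  n≤exponent (suc n) k = s≤s (ℕ.≤-trans (n≤exponent n (suc k)) (ℕ.m≤n+m _ k))

  signPow-square : ∀ n → signPow n * signPow n ≡ + 1
  signPow-square zero    = refl
  signPow-square (suc n) = trans (lemma (signPow n)) (signPow-square n)
    where
    lemma : ∀ x → - x * - x ≡ x * x
    lemma = solve-∀

  signPow-shift : ∀ r n → signPow r * signPow (r ℕ.+ n) ≡ signPow n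
  signPow-shift zero    n = ℤ.*-identityˡ _
  signPow-shift (suc r) n = trans (lemma (signPow r) (signPow (r ℕ.+ n))) (signPow-shift r n)
    where
    lemma : ∀ x y → - x * - y ≡ x * y
    lemma = solve-∀

  symmetric-sum : ∀ K L (f : ℕ → ℕ → ℤ) → K ≤ L → (∀ r s → f r s ≡ f s r) → (∀ r s → K ≤ s → f r s ≡ + 0) →
    + 2 * sumℤ K (λ r → sumℤ L (λ m → f r (r ℕ.+ m))) ≡
    sumℤ K (λ r → sumℤ K (f r)) + sumℤ K (λ r → f r r)
  symmetric-sum zero    L f K≤L f-sym f≡0 = refl
  symmetric-sum (suc K) L f K<L f-sym f≡0 = begin
    + 2 * sumℤ (suc K) (λ r → sumℤ L (λ m → f r (r ℕ.+ m)))
      ≡⟨ cong (+ 2 *_) (sumℤ-cons K _) ⟩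
    + 2 * (sumℤ L (f 0) + sumℤ K (λ r → sumℤ L (λ m → f′ r (r ℕ.+ m))))
      ≡⟨ cong (λ x → + 2 * (x + sumℤ K (λ r → sumℤ L (λ m → f′ r (r ℕ.+ m)))))
           -- Row 0 is cut back from length `L` to the width of the square.
           (trans (sumℤ-stable (f 0) K<L (f≡0 0)) (sumℤ-cons K (f 0))) ⟩
    + 2 * (f 0 0 + row + sumℤ K (λ r → sumℤ L (λ m → f′ r (r ℕ.+ m))))
      ≡⟨ expand (f 0 0) row _ ⟩
    (f 0 0 + row) + (row + + 2 * sumℤ K (λ r → sumℤ L (λ m → f′ r (r ℕ.+ m)))) + f 0 0
      ≡⟨ cong (λ x → (f 0 0 + row) + (row + x) + f 0 0)
           (symmetric-sum K L f′ (ℕ.≤-trans (ℕ.n≤1+n K) K<L) (λ r s → f-sym (suc r) (suc s)) (λ r s K≤s → f≡0 (suc r) (suc s) (s≤s K≤s))) ⟩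
    (f 0 0 + row) + (row + (sumℤ K (λ r → sumℤ K (f′ r)) + sumℤ K (λ r → f′ r r))) + f 0 0
      ≡⟨ collect (f 0 0) row _ _ ⟩
    (f 0 0 + row) + (row + sumℤ K (λ r → sumℤ K (f′ r))) + (f 0 0 + sumℤ K (λ r → f′ r r))
      ≡⟨ cong₂ _+_ (cong₂ _+_ (sumℤ-cons K (f 0)) columns) (sumℤ-cons K (λ r → f r r)) ⟨
    sumℤ (suc K) (f 0) + sumℤ K (λ r → sumℤ (suc K) (f (suc r))) + sumℤ (suc K) (λ r → f r r)
      ≡⟨ cong (_+ sumℤ (suc K) (λ r → f r r)) (sumℤ-cons K (λ r → sumℤ (suc K) (f r))) ⟨
    sumℤ (suc K) (λ r → sumℤ (suc K) (f r)) + sumℤ (suc K) (λ r → f r r) ∎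
    where
    f′ : ℕ → ℕ → ℤ
    f′ r s = f (suc r) (suc s)

    row : ℤ
    row = sumℤ K (f 0 ∘ suc)

    columns : sumℤ K (λ r → sumℤ (suc K) (f (suc r))) ≡ row + sumℤ K (λ r → sumℤ K (f′ r))
    columns = trans
      (sumℤ-cong K (λ r → trans (sumℤ-cons K (f (suc r))) (cong (_+ sumℤ K (f′ r)) (f-sym (suc r) 0))))
      (sumℤ-+ K (f 0 ∘ suc) (λ r → sumℤ K (f′ r)))

    expand : ∀ x y z → + 2 * (x + y + z) ≡ (x + y) + (y + + 2 * z) + x
    expand = solve-∀
    collect : ∀ x y z w → (x + y) + (y + (z + w)) + x ≡ (x + y) + (y + z) + (x + w)
    collect = solve-∀

  pick : ∀ K n (a : ℕ → ℤ) → n < K → sumℤ K (λ i → mono (a i) i n) ≡ a n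
  pick (suc K) n a (s≤s n≤K) with ℕ.m≤n⇒m<n∨m≡n n≤K
  ... | inj₁ n<K  = trans (cong₂ _+_ (pick K n a n<K) (mono-≢ (a K) (ℕ.<⇒≢ n<K))) (ℤ.+-identityʳ (a n))
  ... | inj₂ refl = trans
    (cong₂ _+_ (sumℤ-≡0 n (λ i i<n → mono-≢ (a i) (ℕ.>⇒≢ i<n))) (mono-≡ (a n) refl))
    (ℤ.+-identityˡ (a n))

  -- The two sides of the theorem

  module _ (N : ℕ) where
    private
      K = suc N

    -- The contribution of a pair of terms to coefficient `N` of q² θ(q)² after q ↦ q⁸; `W` is its
    -- counterpart for the sum with weights n + 1.
    F : ℕ → ℕ → ℤ
    F r t = mono (signPow r * signPow t) (8 ℕ.* (exponent r 1 ℕ.+ exponent t 1) ℕ.+ 2) N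

    W : ℕ → ℤ
    W i = mono (signPow i * + suc i) (8 ℕ.* exponent i 1 ℕ.+ 2) N

    F-sym : ∀ r t → F r t ≡ F t r
    F-sym r t = cong₂ (λ c e → mono c (8 ℕ.* e ℕ.+ 2) N) (ℤ.*-comm (signPow r) (signPow t)) (ℕ.+-comm (exponent r 1) (exponent t 1))

    F≡0 : ∀ r t → K ≤ t → F r t ≡ + 0
    F≡0 r t N<t = mono-≢ _ (ℕ.<⇒≢ (ℕ.≤-trans N<t (ℕ.≤-trans (n≤exponent t 0)
      (ℕ.≤-trans (ℕ.m≤n+m _ (exponent r 1)) (ℕ.≤-trans (ℕ.m≤n*m _ 8) (ℕ.m≤m+n _ 2))))))

    -- With t = r + n the double sum runs over the pairs r ≤ t of a symmetric array. Doubling it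
    -- counts the diagonal once too often, and the last sum of the theorem removes exactly this
    -- surplus.
    rhs-theta : rhs N ≡ sumℤ K (λ r → sumℤ K (F r)) - sumℤ K W
    rhs-theta = begin
      rhs N
        ≡⟨ cong₂ _-_ (cong₂ _-_
             (cong (+ 2 *_) (trans (sumPS-coeff K _ N) (sumℤ-cong K (λ r → trans (sumPS-coeff K _ N) (sumℤ-cong K (off-diagonal r))))))
             (trans (sumPS-coeff K _ N) (sumℤ-cong K weighted)))
             (trans (sumPS-coeff K _ N) (sumℤ-cong K diagonal)) ⟩
      + 2 * sumℤ K (λ r → sumℤ K (λ m → F r (r ℕ.+ m))) - sumℤ K W - sumℤ K (λ r → F r r)
        ≡⟨ cong (λ x → x - sumℤ K W - sumℤ K (λ r → F r r)) (symmetric-sum K K F ℕ.≤-refl F-sym F≡0) ⟩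
      sumℤ K (λ r → sumℤ K (F r)) + sumℤ K (λ r → F r r) - sumℤ K W - sumℤ K (λ r → F r r)
        ≡⟨ cancel (sumℤ K (λ r → sumℤ K (F r))) _ _ ⟩
      sumℤ K (λ r → sumℤ K (F r)) - sumℤ K W ∎
      where
      cancel : ∀ x y z → x + y - z - y ≡ x - z
      cancel = solve-∀

      regroup : ∀ x y → (8 ℕ.* x ℕ.+ 1) ℕ.+ (8 ℕ.* y ℕ.+ 1) ≡ 8 ℕ.* (x ℕ.+ y) ℕ.+ 2
      regroup = ℕSolver.solve-∀

      odd-+ : ∀ r m → 2 ℕ.* r ℕ.+ 1 ℕ.+ 2 ℕ.* m ≡ 2 ℕ.* (r ℕ.+ m) ℕ.+ 1
      odd-+ = ℕSolver.solve-∀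

      off-diagonal : ∀ r m → mono (signPow m) (sq (2 ℕ.* r ℕ.+ 1) ℕ.+ sq (2 ℕ.* r ℕ.+ 1 ℕ.+ 2 ℕ.* m)) N ≡ F r (r ℕ.+ m)
      off-diagonal r m = cong₂ (λ c e → mono c e N) (sym (signPow-shift r m))
        (trans (cong₂ ℕ._+_ (sq-odd r) (trans (cong sq (odd-+ r m)) (sq-odd (r ℕ.+ m))))
          (regroup (exponent r 1) (exponent (r ℕ.+ m) 1)))

      weighted : ∀ i → mono (signPow i * + suc i) (1 ℕ.+ sq (2 ℕ.* i ℕ.+ 1)) N ≡ W i
      weighted i = cong (λ e → mono (signPow i * + suc i) e N)
        (trans (cong suc (sq-odd i)) (sym (ℕ.+-suc (8 ℕ.* exponent i 1) 1)))

      diagonal : ∀ i → mono (+ 1) (2 ℕ.* sq (2 ℕ.* i ℕ.+ 1)) N ≡ F i i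
      diagonal i = cong₂ (λ c e → mono c e N) (sym (signPow-square i))
        (trans (cong (λ x → x ℕ.+ (x ℕ.+ 0)) (sq-odd i))
          (trans (cong ((8 ℕ.* exponent i 1 ℕ.+ 1) ℕ.+_) (ℕ.+-identityʳ _)) (regroup (exponent i 1) (exponent i 1))))

    lhs-sum : lhs N ≡ sumℤ K (λ i → mono (D' (suc i)) (8 ℕ.* suc i ℕ.+ 2) N)
    lhs-sum = sumPS-coeff K _ N

  mono-8n+2 : ∀ c e n → mono c (8 ℕ.* e ℕ.+ 2) (8 ℕ.* n ℕ.+ 2) ≡ mono c e n
  mono-8n+2 c e n = mono-reindex c
    (λ eq → ℕ.*-cancelˡ-≡ n e 8 (ℕ.+-cancelʳ-≡ 2 _ _ eq))
    (cong (λ x → 8 ℕ.* x ℕ.+ 2))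

  shift-suc-0 : ∀ e f → shift (suc e) f 0 ≡ + 0
  shift-suc-0 e f = trans (ℤ.+-identityˡ _) (ℤ.*-zeroˡ (f 0))

  -- The left-hand series starts at n = 1, so coefficient 2 of both sides has to be compared with
  -- `D' 0`.
  D'0≡0 : D' 0 ≡ + 0
  D'0≡0 = trans (D'-sum 0) (sumℤ-≡0 1 {λ i → D'-term i 0} (λ i _ → D'-term-0 i))
    where
    D'-term-0 : ∀ i → D'-term i 0 ≡ + 0
    D'-term-0 i = shift-suc-0 (i ℕ.+ (suc i ℕ.+ 0)) (cube (pochInf (suc (suc i))) ⊛ poch (suc i) (suc i))

  lhs-8n+2 : ∀ n → lhs (8 ℕ.* n ℕ.+ 2) ≡ D' n
  lhs-8n+2 n = begin
    lhs N
      ≡⟨ lhs-sum N ⟩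
    sumℤ (suc N) (λ i → mono (D' (suc i)) (8 ℕ.* suc i ℕ.+ 2) N)
      ≡⟨ sumℤ-cong (suc N) (λ i → mono-8n+2 (D' (suc i)) (suc i) n) ⟩
    sumℤ (suc N) (λ i → mono (D' (suc i)) (suc i) n)
      ≡⟨ ℤ.+-identityˡ _ ⟨
    + 0 + sumℤ (suc N) (λ i → mono (D' (suc i)) (suc i) n)
      -- A vanishing term with index 0 is put in front, so that `pick` can treat n = 0 like every
      -- other n.
      ≡⟨ cong (_+ sumℤ (suc N) (λ i → mono (D' (suc i)) (suc i) n)) (D'0 n) ⟨
    mono (D' 0) 0 n + sumℤ (suc N) (λ i → mono (D' (suc i)) (suc i) n)
      ≡⟨ sumℤ-cons (suc N) (λ i → mono (D' i) i n) ⟨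
    sumℤ (suc (suc N)) (λ i → mono (D' i) i n)
      ≡⟨ pick (suc (suc N)) n D' (s≤s (ℕ.m≤n⇒m≤1+n (ℕ.≤-trans (ℕ.m≤n*m n 8) (ℕ.m≤m+n _ 2)))) ⟩
    D' n ∎
    where
    N = 8 ℕ.* n ℕ.+ 2
    D'0 : ∀ k → mono (D' 0) 0 k ≡ + 0
    D'0 k = trans (cong (λ c → mono c 0 k) D'0≡0) (sym (mono-map (λ _ → + 0) refl (+ 0) 0 k))

  rhs-8n+2 : ∀ n → rhs (8 ℕ.* n ℕ.+ 2) ≡ D' n
  rhs-8n+2 n = begin
    rhs N
      ≡⟨ rhs-theta N ⟩
    sumℤ (suc N) (λ r → sumℤ (suc N) (F N r)) - sumℤ (suc N) (W N)
      ≡⟨ cong₂ _-_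
           (sumℤ-cong (suc N) (λ r → sumℤ-cong (suc N) (λ t →
             mono-8n+2 (signPow r * signPow t) (exponent r 1 ℕ.+ exponent t 1) n)))
           (sumℤ-cong (suc N) (λ i → mono-8n+2 (signPow i * + suc i) (exponent i 1) n)) ⟩
    -- The free length `M` is taken to be 8 n + 2, the cut-off of the sums in `rhs`.
    _ ≡⟨ D'-coeff n n<N ⟨
    D' n ∎
    where
    N = 8 ℕ.* n ℕ.+ 2
    n<N : n < N
    n<N = ℕ.≤-trans (ℕ.≤-reflexive (ℕ.+-comm 1 n)) (ℕ.+-mono-≤ (ℕ.m≤n*m n 8) (s≤s z≤n))

  lhs-other : ∀ N → (∀ e → N ≢ 8 ℕ.* e ℕ.+ 2) → lhs N ≡ + 0
  lhs-other N N≢ = trans (lhs-sum N) (sumℤ-≡0 (suc N) (λ i _ → mono-≢ (D' (suc i)) (N≢ (suc i))))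

  rhs-other : ∀ N → (∀ e → N ≢ 8 ℕ.* e ℕ.+ 2) → rhs N ≡ + 0
  rhs-other N N≢ = trans (rhs-theta N) (cong₂ _-_
    (sumℤ-≡0 (suc N) (λ r _ → sumℤ-≡0 (suc N) (λ t _ → mono-≢ _ (N≢ (exponent r 1 ℕ.+ exponent t 1)))))
    (sumℤ-≡0 (suc N) (λ i _ → mono-≢ _ (N≢ (exponent i 1)))))

theorem1p6 : ∀ N → lhs N ≡ rhs N
-- Coefficients outside the class of 2 modulo 8 vanish on both sides. Any n with N = 8 n + 2 is at
-- most `N`, so the bounded search is exhaustive.
theorem1p6 N = by-residue (ℕ.anyUpTo? (λ n → N ℕ.≟ 8 ℕ.* n ℕ.+ 2) (suc N))
  where
  by-residue : Dec (∃ λ n → n < suc N Product.× N ≡ 8 ℕ.* n ℕ.+ 2) → lhs N ≡ rhs N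
  by-residue (yes (n , _ , N≡)) = ≡.subst (λ k → lhs k ≡ rhs k) (≡.sym N≡) (≡.trans (lhs-8n+2 n) (≡.sym (rhs-8n+2 n)))
  by-residue (no ∄n) = ≡.trans (lhs-other N N≢) (≡.sym (rhs-other N N≢))
    where
    N≢ : ∀ e → N ≢ 8 ℕ.* e ℕ.+ 2
    N≢ e N≡ = ∄n (e , s≤s (ℕ.≤-trans (ℕ.≤-trans (ℕ.m≤n*m e 8) (ℕ.m≤m+n _ 2)) (ℕ.≤-reflexive (≡.sym N≡))) , N≡)
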